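{- Let $P$ be any set of $n\geq 3$ points in general position in the plane, and let $D(P)$ be its edge disjointness graph. If the minimum degree of $D(P)$ satisfies $$\delta(D(P))=\binom{\lfloor\frac{n-2}{2}\rfloor}{2}+\binom{\lceil\frac{n-2}{2}\rceil}{2},$$ then $$\kappa(D(P))=\binom{\lfloor\frac{n-2}{2}\rfloor}{2}+\binom{\lceil\frac{n-2}{2}\rceil}{2}.$$
   Context: A point set in the plane is in general position if no three of its points are collinear. The edge disjointness graph $D(P)$ is the graph whose vertices are all the closed straight line segments $xy$ with distinct endpoints $x,y\in P$; two vertices are adjacent if and only if the corresponding segments are disjoint. $\delta(H)$ denotes the minimum degree of a graph $H$. A graph $H$ is $k$-connected ($k\ge 0$ an integer) if $|V(H)|>k$ and $H\setminus W$ is connected for every $W\subset V(H)$ with $|W|<k$. The connectivity $\kappa(H)$ is the greatest integer $k$ such that $H$ is $k$-connected, with $\kappa(H)=0$ if and only if $H$ is disconnected or $|V(H)|=1$. By convention $\binom{m}{2}=0$ if $m<2$. -}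

module Defs where

open import Algebra.Bundles using (CommutativeRing)
import Algebra.Definitions.RawMonoid as RawMonoidMultiples
open import Data.Fin.Base using (Fin)
open import Data.Fin.Properties using (_<?_)
open import Data.Fin.Subset using (Subset; _∈_; _∉_; ∣_∣)
open import Data.List.Base using (List; allFin; cartesianProduct; filter; length; lookup)
open import Data.Nat.Base as ℕ using (ℕ)
open import Data.Product.Base using (∃; ∃-syntax; _×_; _,_; proj₁; proj₂)
open import Data.Product.Relation.Binary.Pointwise.NonDependent using (Pointwise)
open import Data.Sum.Base using (_⊎_)
open import Function.Bundles using (_⇔_)
open import Function.Definitions using (Injective)
open import Level using (Level; suc; _⊔_)
open import Relation.Binary.Construct.Closure.ReflexiveTransitive using (Star)
open import Relation.Binary.Core using (Rel)
open import Relation.Binary.Definitions using (Cotransitive)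
open import Relation.Binary.PropositionalEquality.Core using (_≡_; _≢_)
open import Relation.Binary.Structures using (IsStrictPartialOrder)
open import Relation.Nullary.Negation.Core using (¬_)

-- The real numbers, as an Archimedean, Cauchy-complete ordered field.
-- Classically this determines ℝ up to isomorphism. Trichotomy is replaced by
-- cotransitivity and tightness (equivalent to it classically), so that
-- Bishop's reals are also a model.

record RealField (c ℓ₁ ℓ₂ : Level) : Set (suc (c ⊔ ℓ₁ ⊔ ℓ₂)) where
  infix 4 _<_ _≤_ _#_
  field
    commutativeRing : CommutativeRing c ℓ₁

  open CommutativeRing commutativeRing public
  open RawMonoidMultiples +-rawMonoid public using () renaming (_×_ to _·_)

  field
    _<_                  : Rel Carrier ℓ₂
    isStrictPartialOrder : IsStrictPartialOrder _≈_ _<_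
    <-cotransitive       : Cotransitive _<_

  _≤_ : Rel Carrier ℓ₂
  x ≤ y = ¬ (y < x)

  _#_ : Rel Carrier ℓ₂
  x # y = x < y ⊎ y < x

  -- Differences are taken in both orders because m and n are interchangeable.
  IsCauchy : (ℕ → Carrier) → Set (c ⊔ ℓ₂)
  IsCauchy s = ∀ ε → 0# < ε →
    ∃[ N ] (∀ m n → N ℕ.≤ m → N ℕ.≤ n → s m - s n < ε)

  _ConvergesTo_ : (ℕ → Carrier) → Carrier → Set (c ⊔ ℓ₂)
  s ConvergesTo l = ∀ ε → 0# < ε →
    ∃[ N ] (∀ n → N ℕ.≤ n → s n - l < ε × l - s n < ε)

  field
    ≤-antisym    : ∀ {x y} → x ≤ y → y ≤ x → x ≈ y
    +-monoˡ-<    : ∀ z {x y} → x < y → x + z < y + z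
    *-positive   : ∀ {x y} → 0# < x → 0# < y → 0# < x * y
    0<1          : 0# < 1#
    #0⇒inverse   : ∀ {x} → x # 0# → ∃[ y ] x * y ≈ 1#
    archimedean  : ∀ x → ∃[ n ] x < n · 1#
    complete     : ∀ s → IsCauchy s → ∃[ l ] s ConvergesTo l

-- Finite simple graphs, with vertex set Fin order.

record Graph (a : Level) : Set (suc a) where
  infix 4 _~_
  field
    order    : ℕ
    _~_      : Rel (Fin order) a
    ~-sym    : ∀ {u v} → u ~ v → v ~ u
    ~-irrefl : ∀ {v} → ¬ (v ~ v)

module _ {a : Level} (H : Graph a) where
  open Graph H

  -- Relational, since adjacency need not be decidable.
  HasDegree : Fin order → ℕ → Set a
  HasDegree v d =
    ∃[ N ] (∀ u → u ∈ N ⇔ v ~ u) × ∣ N ∣ ≡ d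

  HasMinimumDegree : ℕ → Set a
  HasMinimumDegree d =
    (∃[ v ] HasDegree v d) × (∀ v e → HasDegree v e → d ℕ.≤ e)

  -- H ∖ W is connected: walks may only use edges with both ends outside W.
  ConnectedWithout : Subset order → Set a
  ConnectedWithout W = ∀ u v → u ∉ W → v ∉ W →
    Star (λ x y → x ∉ W × y ∉ W × x ~ y) u v

  IsConnected : ℕ → Set a
  IsConnected k = k ℕ.< order × (∀ W → ∣ W ∣ ℕ.< k → ConnectedWithout W)

  HasConnectivity : ℕ → Set a
  HasConnectivity k = IsConnected k × (∀ j → IsConnected j → j ℕ.≤ k)

module Plane {c ℓ₁ ℓ₂ : Level} (ℝ : RealField c ℓ₁ ℓ₂) where
  open RealField ℝ

  Point : Set c
  Point = Carrier × Carrier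

  infix 4 _≈ₚ_
  _≈ₚ_ : Rel Point ℓ₁
  _≈ₚ_ = Pointwise _≈_ _≈_

  -- det (q - p , r - p)
  orientation : Point → Point → Point → Carrier
  orientation (p₁ , p₂) (q₁ , q₂) (r₁ , r₂) =
    (q₁ - p₁) * (r₂ - p₂) - (q₂ - p₂) * (r₁ - p₁)

  -- Stated with apartness: the positive form of "p, q, r are not collinear",
  -- and equivalent to it as soon as < is decidable.
  NonCollinear : Point → Point → Point → Set ℓ₂
  NonCollinear p q r = orientation p q r # 0#

  -- An n-element point set, listed without repetition, no three of its points
  -- collinear.
  record InGeneralPosition {n : ℕ} (P : Fin n → Point) : Set (ℓ₁ ⊔ ℓ₂) where
    field
      distinct     : Injective _≡_ _≈ₚ_ P
      nonCollinear : ∀ i j k → i ≢ j → j ≢ k → i ≢ k →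
                     NonCollinear (P i) (P j) (P k)

  -- affine combination, parametrising the segment by 0 ≤ t ≤ 1
  along : Point → Point → Carrier → Point
  along (x₁ , x₂) (y₁ , y₂) t =
    (1# - t) * x₁ + t * y₁ , (1# - t) * x₂ + t * y₂

  OnSegment : Point × Point → Point → Set (c ⊔ ℓ₁ ⊔ ℓ₂)
  OnSegment (x , y) z = ∃[ t ] 0# ≤ t × t ≤ 1# × z ≈ₚ along x y t

  Disjoint : Rel (Point × Point) (c ⊔ ℓ₁ ⊔ ℓ₂)
  Disjoint s s′ = ¬ (∃[ z ] OnSegment s z × OnSegment s′ z)

  -- Each unordered pair {i , j} with i ≢ j occurs exactly once, as i < j.
  pairs : ∀ n → List (Fin n × Fin n)
  pairs n = filter (λ (i , j) → i <? j) (cartesianProduct (allFin n) (allFin n))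

  segment : ∀ {n} → (Fin n → Point) → Fin (length (pairs n)) → Point × Point
  segment {n} P v = let (i , j) = lookup (pairs n) v in P i , P j

  Disjoint-irrefl : ∀ s → ¬ Disjoint s s
  Disjoint-irrefl (x , y) disjoint = disjoint (along x y 0# , onSegment , onSegment)
    where
    open IsStrictPartialOrder isStrictPartialOrder using (irrefl; asym)
    onSegment : OnSegment (x , y) (along x y 0#)
    onSegment = 0# , irrefl refl , asym 0<1 , refl , refl

  -- The edge disjointness graph of the point set P.
  D : ∀ {n} → (Fin n → Point) → Graph (c ⊔ ℓ₁ ⊔ ℓ₂)
  D {n} P = record
    { order    = length (pairs n)
    ; _~_      = λ u v → Disjoint (segment P u) (segment P v)
    ; ~-sym    = λ disjoint (z , z∈v , z∈u) → disjoint (z , z∈u , z∈v)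
    ; ~-irrefl = λ {v} → Disjoint-irrefl (segment P v)
    }

{-# OPTIONS --safe #-}

-- The neighbourhood of a vertex of minimum degree separates it from the rest, so
-- κ ≤ δ. It remains to see that D(P) stays connected when a set W of fewer than
-- f(n - 2) segments is deleted, where f(m) = C(⌊m/2⌋,2) + C(⌈m/2⌉,2). Equivalently,
-- every colouring of the surviving segments in which disjoint segments agree is
-- constant. As f(a + b) ≤ C(a,2) + C(b,2), the following cannot happen: all but two
-- of the points split into two sets each spanning only segments of W.
-- Proceed by induction on n, removing a point that meets at least
-- ⌊(n-3)/2⌋ = f(n - 2) - f(n - 3) segments of W; a surviving segment xa at a removed
-- point x is disjoint from a surviving segment on one of the two sides of the line xa.
-- To find such a point, let p be extreme and sort the other points by angle around p.
-- If px and py survive in different colours, let t be the first point joined to an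
-- earlier point a by a surviving segment. The points before t span only segments of
-- W, and a surviving segment after t would be disjoint from at and from px or py, in
-- such a way that px and py get the same colour: a contradiction. So all segments px
-- have one colour k. If a segment cd has another colour, the surviving px all cross
-- it or end on it, and segments among their ends other than c and d again differ in
-- colour from k. Repeating this once shows that, up to two points, these ends span
-- only segments of W, so p or one of them has the required W-degree.

module Submission where

open import Defs
open import Data.Fin.Base using (Fin)
open import Level using (Level)

open import Algebra.Bundles using (CommutativeRing; RawRing)
import Algebra.Properties.CommutativeSemigroup as CommutativeSemigroupProperties
import Algebra.Properties.Ring as RingProperties
import Algebra.Properties.Semiring.Mult as SemiringMult
import Algebra.Solver.Ring as RingSolver
open import Algebra.Solver.Ring.AlmostCommutativeRing
  using (fromCommutativeRing; _-Raw-AlmostCommutative⟶_; Induced-equivalence)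
open import Data.Bool.Base using (Bool)
import Data.Bool.Properties as Bool
import Data.Fin.Base as Fin
import Data.Fin.Properties as Fin
open import Data.Fin.Subset using (Subset; _∉_; ∣_∣) renaming (_∈_ to _∈ₛ_; _-_ to _without_)
open import Data.Fin.Subset.Properties
  using (_∈?_; x∈p⇒∣p-x∣<∣p∣; x∈p∧x≢y⇒x∈p-y; ∣⊤∣≡n; p⊂q⇒∣p∣<∣q∣; ⊆-max; ∈⊤)
open import Data.List.Base
  using (List; []; _∷_; [_]; _++_; length; filter; map; lookup; allFin; cartesianProduct)
open import Data.List.Membership.Propositional using (_∈_; find)
open import Data.List.Membership.Propositional.Properties
  using (∈-++⁺ˡ; ∈-++⁺ʳ; ∈-++⁻; ∈-∃++; ∈-filter⁺; ∈-filter⁻; ∈-cartesianProduct⁺; ∈-allFin;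
         ∈-lookup; ∈-map⁻)
open import Data.List.Properties
  using (length-++; length-map; length-tabulate; filter-all; filter-++; ++-identityʳ; ++-assoc)
open import Data.List.Relation.Binary.Permutation.Propositional
  using (_↭_; refl; prep; swap; trans; ↭-refl; ↭-sym; ↭-trans; ↭⇒↭ₛ)
open import Data.List.Relation.Binary.Permutation.Propositional.Properties
  using (All-resp-↭; ∈-resp-↭; ↭-length; shift; filter-↭)
import Data.List.Relation.Binary.Permutation.Setoid.Properties as Permutation
open import Data.List.Relation.Binary.Sublist.Propositional using (_⊆_; []; _∷_; _∷ʳ_; ⊆-trans)
open import Data.List.Relation.Binary.Sublist.Propositional.Properties using (filter-⊆)
open import Data.List.Relation.Unary.All as All using (All; []; _∷_)
import Data.List.Relation.Unary.All.Properties as All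
open import Data.List.Relation.Unary.AllPairs as AllPairs using (AllPairs; []; _∷_)
import Data.List.Relation.Unary.AllPairs.Properties as AllPairs
open import Data.List.Relation.Unary.Any as Any using (here; there; any?)
import Data.List.Relation.Unary.Any.Properties as Any
open import Data.List.Relation.Unary.Unique.Propositional using (Unique)
import Data.List.Relation.Unary.Unique.Propositional.Properties as Unique
open import Data.Maybe.Base using (just; nothing)
open import Data.Nat.Base as ℕ using (ℕ; zero; suc; z≤n; s≤s)
open import Data.Nat.Combinatorics using (_C_; nCk+nC[k+1]≡[n+1]C[k+1]; nC1≡n)
import Data.Nat.Properties as ℕ
open import Data.Nat.Solver using (module +-*-Solver)
open import Data.Product.Base as Product using (∃; ∃₂; _×_; _,_; proj₁; proj₂)
open import Data.Product.Properties using (,-injective)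
open import Data.Sum.Base as Sum using (_⊎_; inj₁; inj₂)
open import Function.Base using (_∘_; flip; id)
open import Function.Bundles using (Equivalence)
open import Relation.Binary.Construct.Closure.ReflexiveTransitive as Star using (Star; ε; _◅_; _◅◅_)
open import Relation.Binary.Core using (Rel)
open import Relation.Binary.Definitions
  using (Decidable; DecidableEquality; Symmetric; WeaklyDecidable; tri<; tri≈; tri>)
open import Relation.Binary.PropositionalEquality as ≡ using (_≡_; _≢_; refl; sym; cong; cong₂; subst)
import Relation.Binary.Reasoning.Setoid as SetoidReasoning
open import Relation.Binary.Structures using (IsStrictPartialOrder)
open import Relation.Nullary.Decidable
  using (Dec; yes; no; does; ¬?; _×-dec_; _⊎-dec_; decidable-stable)
open import Relation.Nullary.Negation using (¬_; contradiction)
import Relation.Unary as U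

Unique-resp-↭ : ∀ {a} {A : Set a} {xs ys : List A} → xs ↭ ys → Unique xs → Unique ys
Unique-resp-↭ xs↭ys = Permutation.Unique-resp-↭ (≡.setoid _) (↭⇒↭ₛ xs↭ys)

-- Polynomial identities over a commutative ring.

-- A pair (m , n) stands for the integer m - n. Any commutative ring receives
-- these coefficients, which lets the solver cancel without deciding equality.
module DifferenceSolver {c ℓ : Level} (R : CommutativeRing c ℓ) where
  open CommutativeRing R
  open RingProperties ring using (-‿+-comm; -‿involutive; -0#≈0#; [y-z]x≈yx-zx; x[y-z]≈xy-xz)
  open SemiringMult semiring using (×-homo-+; ×1-homo-*; ×-homo-1) renaming (_×_ to _·_)
  open CommutativeSemigroupProperties (CommutativeRing.+-commutativeSemigroup R) using (interchange)
  open SetoidReasoning setoid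

  coefficients : RawRing _ _
  coefficients = record
    { Carrier = ℕ × ℕ
    ; _≈_ = _≡_
    ; _+_ = λ (a , b) (c , d) → a ℕ.+ c , b ℕ.+ d
    ; _*_ = λ (a , b) (c , d) → a ℕ.* c ℕ.+ b ℕ.* d , a ℕ.* d ℕ.+ b ℕ.* c
    ; -_ = λ (a , b) → b , a
    ; 0# = 0 , 0
    ; 1# = 1 , 0
    }

  +-minus-+ : ∀ w x y z → (w + x) - (y + z) ≈ (w - y) + (x - z)
  +-minus-+ w x y z = begin
    (w + x) - (y + z)        ≈⟨ +-congˡ (-‿+-comm y z) ⟨
    (w + x) + (- y + - z)    ≈⟨ interchange w x (- y) (- z) ⟩
    (w - y) + (x - z)        ∎

  neg-minus : ∀ x y → y - x ≈ - (x - y)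
  neg-minus x y = begin
    y - x            ≈⟨ +-comm y (- x) ⟩
    - x + y          ≈⟨ +-congˡ (-‿involutive y) ⟨
    - x + - (- y)    ≈⟨ -‿+-comm x (- y) ⟩
    - (x - y)        ∎

  ⟦_⟧ : ℕ × ℕ → Carrier
  ⟦ a , b ⟧ = a · 1# - b · 1#

  *-homo : ∀ a b c d → ⟦ a ℕ.* c ℕ.+ b ℕ.* d , a ℕ.* d ℕ.+ b ℕ.* c ⟧ ≈ ⟦ a , b ⟧ * ⟦ c , d ⟧
  *-homo a b c d = begin
    (a ℕ.* c ℕ.+ b ℕ.* d) · 1# - (a ℕ.* d ℕ.+ b ℕ.* c) · 1#
      ≈⟨ +-cong (expand a c b d) (-‿cong (expand a d b c)) ⟩
    (w * y + x * z) - (w * z + x * y)    ≈⟨ +-minus-+ (w * y) (x * z) (w * z) (x * y) ⟩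
    (w * y - w * z) + (x * z - x * y)    ≈⟨ +-congˡ (neg-minus (x * y) (x * z)) ⟩
    (w * y - w * z) - (x * y - x * z)    ≈⟨ +-cong (x[y-z]≈xy-xz w y z) (-‿cong (x[y-z]≈xy-xz x y z)) ⟨
    w * (y - z) - x * (y - z)            ≈⟨ [y-z]x≈yx-zx (y - z) w x ⟨
    (w - x) * (y - z)                    ∎
    where
    w = a · 1#
    x = b · 1#
    y = c · 1#
    z = d · 1#
    expand : ∀ i j k l → (i ℕ.* j ℕ.+ k ℕ.* l) · 1# ≈ (i · 1#) * (j · 1#) + (k · 1#) * (l · 1#)
    expand i j k l = CommutativeRing.trans R
      (×-homo-+ 1# (i ℕ.* j) (k ℕ.* l)) (+-cong (×1-homo-* i j) (×1-homo-* k l))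

  morphism : coefficients -Raw-AlmostCommutative⟶ fromCommutativeRing R
  morphism = record
    { ⟦_⟧ = ⟦_⟧
    ; +-homo = λ (a , b) (c , d) → CommutativeRing.trans R
        (+-cong (×-homo-+ 1# a c) (-‿cong (×-homo-+ 1# b d))) (+-minus-+ _ _ _ _)
    ; *-homo = λ (a , b) (c , d) → *-homo a b c d
    ; -‿homo = λ (a , b) → neg-minus _ _
    ; 0-homo = -‿inverseʳ 0#
    ; 1-homo = CommutativeRing.trans R (+-cong (×-homo-1 1#) -0#≈0#) (+-identityʳ 1#)
    }

  -- The integers `a - b` and `c - d` are compared through `a + d` and `c + b` in ℕ. A negative
  -- answer yields only `nothing`, since distinct integers may coincide in the ring.
  ⟦⟧-≟ : WeaklyDecidable (Induced-equivalence morphism)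
  ⟦⟧-≟ (a , b) (c , d) with a ℕ.+ d ℕ.≟ c ℕ.+ b
  ... | no _ = nothing
  ... | yes eq = just (begin
    w - x                      ≈⟨ +-identityʳ _ ⟨
    (w - x) + 0#               ≈⟨ +-congˡ (-‿inverseʳ z) ⟨
    (w - x) + (z - z)          ≈⟨ +-minus-+ w z x z ⟨
    (w + z) - (x + z)          ≈⟨ +-cong w+z≈y+x (-‿cong (+-comm x z)) ⟩
    (y + x) - (z + x)          ≈⟨ +-minus-+ y x z x ⟩
    (y - z) + (x - x)          ≈⟨ +-congˡ (-‿inverseʳ x) ⟩
    (y - z) + 0#               ≈⟨ +-identityʳ _ ⟩
    y - z                      ∎)
    where
    w = a · 1#
    x = b · 1#
    y = c · 1#
    z = d · 1#
    w+z≈y+x : w + z ≈ y + x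
    w+z≈y+x = CommutativeRing.trans R (CommutativeRing.sym R (×-homo-+ 1# a d))
      (CommutativeRing.trans R (reflexive (cong (_· 1#) eq)) (×-homo-+ 1# c b))

  open RingSolver coefficients (fromCommutativeRing R) morphism ⟦⟧-≟ public
    using (solve; _:=_; _:+_; _:*_; _:-_; :-_)

-- Totality and transitivity are asked for only on `Q`, because the angular order around a point is
-- linear only on an open half-plane.
insertionSort : ∀ {a q r} {A : Set a} {Q : U.Pred A q} {R : Rel A r} →
  (∀ {x y} → Q x → Q y → x ≢ y → R x y ⊎ R y x) →
  (∀ {x y z} → Q x → Q y → Q z → R x y → R y z → R x z) →
  ∀ xs → Unique xs → All Q xs → ∃ λ ys → xs ↭ ys × AllPairs R ys
insertionSort {Q = Q} {R} R-total R-trans = sort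
  where
  insert : ∀ x ys → All (x ≢_) ys → Q x → All Q ys → AllPairs R ys →
           ∃ λ zs → x ∷ ys ↭ zs × AllPairs R zs
  insert x [] _ _ _ _ = [ x ] , refl , [] ∷ []
  insert x (y ∷ ys) (x≢y ∷ x≢ys) qx (qy ∷ qys) (y<ys ∷ sorted) with R-total qx qy x≢y
  ... | inj₁ x<y = x ∷ y ∷ ys , refl ,
    (x<y ∷ All.zipWith (λ (qz , y<z) → R-trans qx qy qz x<y y<z) (qys , y<ys)) ∷ y<ys ∷ sorted
  ... | inj₂ y<x with zs , xys↭ , sorted′ ← insert x ys x≢ys qx qys sorted =
    y ∷ zs , ↭-trans (swap x y refl) (prep y xys↭) , All-resp-↭ xys↭ (y<x ∷ y<ys) ∷ sorted′

  sort : ∀ xs → Unique xs → All Q xs → ∃ λ ys → xs ↭ ys × AllPairs R ys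
  sort [] _ _ = [] , refl , []
  sort (x ∷ xs) (x≢xs ∷ uniq) (qx ∷ qxs)
    with ys , xs↭ys , sorted ← sort xs uniq qxs
    with zs , ↭zs , sorted′ ← insert x ys (All-resp-↭ xs↭ys x≢xs) qx (All-resp-↭ xs↭ys qxs) sorted =
    zs , ↭-trans (prep x xs↭ys) ↭zs , sorted′

-- In general position `u` and `v` are the only points of the set on their line. So this is the
-- closed half-plane to the right of the directed line from `u` to `v`, with `L v u a` as its
-- interior.
OnOrRight : ∀ {r} {V : Set} → (V → V → V → Set r) → V → V → V → Set r
OnOrRight L u v a = a ≡ u ⊎ a ≡ v ⊎ L v u a

-- Oriented areas and separating lines.

module Orientation {c ℓ₁ ℓ₂ : Level} (ℝ : RealField c ℓ₁ ℓ₂) where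
  open RealField ℝ hiding (refl; sym; trans)
  open Plane ℝ
  open DifferenceSolver commutativeRing using (solve; _:=_; _:+_; _:*_; _:-_; :-_)
  open RingProperties ring using (-0#≈0#)
  private
    module E = CommutativeRing commutativeRing
    module S = IsStrictPartialOrder isStrictPartialOrder

  infixl 6 _⊖_
  _⊖_ : Point → Point → Point
  (x₁ , x₂) ⊖ (y₁ , y₂) = x₁ - y₁ , x₂ - y₂

  cross : Point → Point → Carrier
  cross (x₁ , x₂) (y₁ , y₂) = x₁ * y₂ - x₂ * y₁

  cross-self : ∀ v → cross v v ≈ 0#
  cross-self (v₁ , v₂) = E.trans (+-congʳ (*-comm v₁ v₂)) (-‿inverseʳ _)

  -- The Grassmann-Plücker relation: cross `v` with the linear dependence a(b×c) + b(c×a) + c(a×b) =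
  -- 0 of three plane vectors.
  plücker : ∀ v a b c →
    cross v b * cross c a + cross v a * cross b c + cross v c * cross a b ≈ 0#
  plücker v@(v₁ , v₂) (a₁ , a₂) (b₁ , b₂) (c₁ , c₂) = E.trans
    (solve 8 (λ v₁ v₂ a₁ a₂ b₁ b₂ c₁ c₂ →
      (v₁ :* b₂ :- v₂ :* b₁) :* (c₁ :* a₂ :- c₂ :* a₁) :+
      (v₁ :* a₂ :- v₂ :* a₁) :* (b₁ :* c₂ :- b₂ :* c₁) :+
      (v₁ :* c₂ :- v₂ :* c₁) :* (a₁ :* b₂ :- a₂ :* b₁) := v₁ :* v₂ :- v₂ :* v₁)
      E.refl v₁ v₂ a₁ a₂ b₁ b₂ c₁ c₂)
    (cross-self v)

  orientation-cyclic : ∀ p q r → orientation p q r ≈ orientation q r p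
  orientation-cyclic (p₁ , p₂) (q₁ , q₂) (r₁ , r₂) = solve 6 (λ p₁ p₂ q₁ q₂ r₁ r₂ →
    (q₁ :- p₁) :* (r₂ :- p₂) :- (q₂ :- p₂) :* (r₁ :- p₁) :=
    (r₁ :- q₁) :* (p₂ :- q₂) :- (r₂ :- q₂) :* (p₁ :- q₁)) E.refl p₁ p₂ q₁ q₂ r₁ r₂

  orientation-flip : ∀ p q r → orientation p r q ≈ - orientation p q r
  orientation-flip (p₁ , p₂) (q₁ , q₂) (r₁ , r₂) = solve 6 (λ p₁ p₂ q₁ q₂ r₁ r₂ →
    (r₁ :- p₁) :* (q₂ :- p₂) :- (r₂ :- p₂) :* (q₁ :- p₁) :=
    :- ((q₁ :- p₁) :* (r₂ :- p₂) :- (q₂ :- p₂) :* (r₁ :- p₁))) E.refl p₁ p₂ q₁ q₂ r₁ r₂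

  orientation-flip₁₂ : ∀ p q r → orientation q p r + orientation p q r ≈ 0#
  orientation-flip₁₂ p q r = begin
    orientation q p r + orientation p q r      ≈⟨ +-congʳ (orientation-cyclic q p r) ⟩
    orientation p r q + orientation p q r      ≈⟨ +-congʳ (orientation-flip p q r) ⟩
    - orientation p q r + orientation p q r    ≈⟨ -‿inverseˡ _ ⟩
    0#                                         ∎
    where open SetoidReasoning setoid

  orientation-degenerate : ∀ p q → orientation p q q ≈ 0#
  orientation-degenerate p q = cross-self (q ⊖ p)

  orientation-degenerate₁ : ∀ p q → orientation p q p ≈ 0#
  orientation-degenerate₁ p q = E.trans (orientation-cyclic p q p) (orientation-degenerate q p)

  -- Write `s - x` as `(s - p) - (x - p)`: the result is the height of `s` above the line `pq` plus
  -- the depth of `x` below it, both scaled by the length of `pq`.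
  orientation-shift : ∀ p q s x → cross (q ⊖ p) (s ⊖ x) ≈ orientation p q s + orientation p x q
  orientation-shift (p₁ , p₂) (q₁ , q₂) (s₁ , s₂) (x₁ , x₂) = E.trans
    (+-cong (*-congˡ (via p₂ s₂ x₂)) (-‿cong (*-congˡ (via p₁ s₁ x₁))))
    (solve 6 (λ d₁ d₂ s₁ s₂ x₁ x₂ →
      d₁ :* (s₂ :- x₂) :- d₂ :* (s₁ :- x₁) :=
      (d₁ :* s₂ :- d₂ :* s₁) :+ (x₁ :* d₂ :- x₂ :* d₁))
      E.refl (q₁ - p₁) (q₂ - p₂) (s₁ - p₁) (s₂ - p₂) (x₁ - p₁) (x₂ - p₂))
    where
    via : ∀ p s x → s - x ≈ (s - p) - (x - p)
    via = solve 3 (λ p s x → s :- x := (s :- p) :- (x :- p)) E.refl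

  orientation-congʳ : ∀ p q {r s} → r ≈ₚ s → orientation p q r ≈ orientation p q s
  orientation-congʳ p q (r₁≈s₁ , r₂≈s₂) =
    +-cong (*-congˡ (+-congʳ r₂≈s₂)) (-‿cong (*-congˡ (+-congʳ r₁≈s₁)))

  orientation-along : ∀ p q x y t →
    orientation p q (along x y t) ≈ (1# - t) * orientation p q x + t * orientation p q y
  orientation-along (p₁ , p₂) (q₁ , q₂) (x₁ , x₂) (y₁ , y₂) t = begin
    d₁ * ((1# - t) * x₂ + t * y₂ - p₂) - d₂ * ((1# - t) * x₁ + t * y₁ - p₁)
      ≈⟨ +-cong (*-congˡ (affine p₂ x₂ y₂)) (-‿cong (*-congˡ (affine p₁ x₁ y₁))) ⟩
    d₁ * ((1# - t) * (x₂ - p₂) + t * (y₂ - p₂)) - d₂ * ((1# - t) * (x₁ - p₁) + t * (y₁ - p₁))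
      ≈⟨ solve 8 (λ d₁ d₂ s t x₁ x₂ y₁ y₂ →
           d₁ :* (s :* x₂ :+ t :* y₂) :- d₂ :* (s :* x₁ :+ t :* y₁) :=
           s :* (d₁ :* x₂ :- d₂ :* x₁) :+ t :* (d₁ :* y₂ :- d₂ :* y₁))
           E.refl d₁ d₂ (1# - t) t (x₁ - p₁) (x₂ - p₂) (y₁ - p₁) (y₂ - p₂) ⟩
    (1# - t) * (d₁ * (x₂ - p₂) - d₂ * (x₁ - p₁)) + t * (d₁ * (y₂ - p₂) - d₂ * (y₁ - p₁))  ∎
    where
    open SetoidReasoning setoid
    d₁ = q₁ - p₁
    d₂ = q₂ - p₂
    affine : ∀ p x y → (1# - t) * x + t * y - p ≈ (1# - t) * (x - p) + t * (y - p)
    -- The unit is passed to the solver as a variable `e`, and `p` is first rewritten as `1# * p`,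
    -- so that the identity holds for every value of `e`.
    affine p x y = E.trans (+-congˡ (-‿cong (E.sym (*-identityˡ p))))
      (solve 5 (λ e t p x y → (e :- t) :* x :+ t :* y :- e :* p :=
                              (e :- t) :* (x :- p) :+ t :* (y :- p)) E.refl 1# t p x y)

  -- x ≥ 0 with the two cases told apart, which ≤ does not provide constructively.
  NonNegative : Carrier → Set _
  NonNegative x = x ≈ 0# ⊎ 0# < x

  +-positive : ∀ {x y} → NonNegative x → 0# < y → 0# < x + y
  +-positive (inj₁ x≈0) 0<y = S.<-respʳ-≈ (E.sym (E.trans (+-congʳ x≈0) (+-identityˡ _))) 0<y
  +-positive (inj₂ 0<x) 0<y = S.trans 0<y (S.<-respˡ-≈ (+-identityˡ _) (+-monoˡ-< _ 0<x))

  +-nonNegative : ∀ {x y} → NonNegative x → NonNegative y → NonNegative (x + y)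
  +-nonNegative x≥0 (inj₂ 0<y) = inj₂ (+-positive x≥0 0<y)
  +-nonNegative (inj₁ x≈0) (inj₁ y≈0) = inj₁ (E.trans (+-cong x≈0 y≈0) (+-identityˡ 0#))
  +-nonNegative (inj₂ 0<x) y≥0@(inj₁ _) = inj₂ (S.<-respʳ-≈ (+-comm _ _) (+-positive y≥0 0<x))

  *-nonNegative : ∀ {x y} → NonNegative x → NonNegative y → NonNegative (x * y)
  *-nonNegative (inj₁ x≈0) _          = inj₁ (E.trans (*-congʳ x≈0) (zeroˡ _))
  *-nonNegative (inj₂ _)   (inj₁ y≈0) = inj₁ (E.trans (*-congˡ y≈0) (zeroʳ _))
  *-nonNegative (inj₂ 0<x) (inj₂ 0<y) = inj₂ (*-positive 0<x 0<y)

  convex-nonNegative : ∀ {s t x y} → NonNegative s → NonNegative t → NonNegative x → NonNegative y →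
                       NonNegative (s * x + t * y)
  convex-nonNegative s≥0 t≥0 x≥0 y≥0 = +-nonNegative (*-nonNegative s≥0 x≥0) (*-nonNegative t≥0 y≥0)

  convex-positive : ∀ {t x y} → NonNegative (1# - t) → NonNegative t → 0# < x → 0# < y →
                    0# < (1# - t) * x + t * y
  convex-positive s≥0 (inj₂ 0<t) 0<x 0<y = +-positive (*-nonNegative s≥0 (inj₂ 0<x)) (*-positive 0<t 0<y)
  convex-positive {t} {x} {y} _ (inj₁ t≈0) 0<x 0<y = S.<-respʳ-≈ (begin
    x                        ≈⟨ *-identityˡ x ⟨
    1# * x                   ≈⟨ *-congʳ (+-identityʳ 1#) ⟨
    (1# + 0#) * x            ≈⟨ *-congʳ (+-congˡ (E.trans (-‿cong t≈0) -0#≈0#)) ⟨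
    (1# - t) * x             ≈⟨ +-identityʳ _ ⟨
    (1# - t) * x + 0#        ≈⟨ +-congˡ (E.trans (*-congʳ t≈0) (zeroˡ y)) ⟨
    (1# - t) * x + t * y     ∎) 0<x
    where open SetoidReasoning setoid

  -- If both alternatives fail, `≤-antisym` still gives `x ≈ 0#`. The double negation does no harm,
  -- as `Disjoint` is itself a negation.
  ≤⇒¬¬nonNegative : ∀ {x} → 0# ≤ x → ¬ ¬ NonNegative x
  ≤⇒¬¬nonNegative 0≤x k = k (inj₁ (≤-antisym (k ∘ inj₂) 0≤x))

  1-t≥0 : ∀ {t} → t ≤ 1# → 0# ≤ 1# - t
  1-t≥0 {t} t≤1 1-t<0 = t≤1 (S.<-respˡ-≈
    (E.trans (+-assoc 1# (- t) t) (E.trans (+-congˡ (-‿inverseˡ t)) (+-identityʳ 1#)))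
    (S.<-respʳ-≈ (+-identityˡ t) (+-monoˡ-< t 1-t<0)))

  positive-asym : ∀ {x y} → x + y ≈ 0# → 0# < x → ¬ (0# < y)
  positive-asym x+y≈0 0<x 0<y = S.irrefl (E.sym x+y≈0) (+-positive (inj₂ 0<x) 0<y)

  -- A common point `z` would make `orientation v u z` nonnegative and `orientation u v z` positive,
  -- although the two sum to zero.
  separated⇒disjoint : ∀ {u v a b c d} →
    NonNegative (orientation v u a) → NonNegative (orientation v u b) →
    0# < orientation u v c → 0# < orientation u v d → Disjoint (a , b) (c , d)
  separated⇒disjoint {u} {v} {a} {b} {c} {d} a≥0 b≥0 c>0 d>0
    (z , (t , 0≤t , t≤1 , z≈ab) , (s , 0≤s , s≤1 , z≈cd)) =
    ≤⇒¬¬nonNegative 0≤t λ t≥0 → ≤⇒¬¬nonNegative (1-t≥0 t≤1) λ t′≥0 →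
    ≤⇒¬¬nonNegative 0≤s λ s≥0 → ≤⇒¬¬nonNegative (1-t≥0 s≤1) λ s′≥0 →
    S.irrefl (E.sym (begin
      ((1# - t) * orientation v u a + t * orientation v u b) +
      ((1# - s) * orientation u v c + s * orientation u v d)
        ≈⟨ +-cong (at v u z≈ab) (at u v z≈cd) ⟨
      orientation v u z + orientation u v z     ≈⟨ orientation-flip₁₂ u v z ⟩
      0#                                        ∎))
      (+-positive (convex-nonNegative t′≥0 t≥0 a≥0 b≥0) (convex-positive s′≥0 s≥0 c>0 d>0))
    where
    open SetoidReasoning setoid
    at : ∀ p q {x y r} → z ≈ₚ along x y r →
         orientation p q z ≈ (1# - r) * orientation p q x + r * orientation p q y
    at p q {x} {y} {r} z≈ = E.trans (orientation-congʳ p q z≈) (orientation-along p q x y r)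

  -- The orientation predicate of points in general position, and extreme points.

  module _ {n : ℕ} (P : Fin n → Point) (generic : InGeneralPosition P) where
    open InGeneralPosition generic

    L : Fin n → Fin n → Fin n → Set _
    L i j k = 0# < orientation (P i) (P j) (P k)

    -sign : ∀ {x} → x < 0# → 0# < - x
    -sign {x} x<0 = S.<-respˡ-≈ (-‿inverseʳ x) (S.<-respʳ-≈ (+-identityˡ (- x)) (+-monoˡ-< (- x) x<0))

    L-total : ∀ {i j k} → i ≢ j → j ≢ k → i ≢ k → L i j k ⊎ L i k j
    L-total {i} {j} {k} i≢j j≢k i≢k with nonCollinear i j k i≢j j≢k i≢k
    ... | inj₂ pos = inj₁ pos
    ... | inj₁ neg = inj₂ (S.<-respʳ-≈ (E.sym (orientation-flip (P i) (P j) (P k))) (-sign neg))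

    L-asym : ∀ {i j k} → L i j k → ¬ L i k j
    L-asym {i} {j} {k} = positive-asym
      (E.trans (+-congˡ (orientation-flip (P i) (P j) (P k))) (-‿inverseʳ _))

    L-cyclic : ∀ {i j k} → L i j k → L j k i
    L-cyclic {i} {j} {k} = S.<-respʳ-≈ (orientation-cyclic (P i) (P j) (P k))

    L⇒≢ : ∀ {i j k} → L i j k → j ≢ k
    L⇒≢ ijk refl = L-asym ijk ijk

    -- General position supplies a sign for each triple of distinct indices, and degenerate triples
    -- are never positive. Hence orientations are decidable even where `_<_` on the field is not.
    L? : ∀ i j k → Dec (L i j k)
    L? i j k with i Fin.≟ j | j Fin.≟ k | i Fin.≟ k
    ... | no i≢j | no j≢k | no i≢k with L-total i≢j j≢k i≢k
    ...   | inj₁ ijk = yes ijk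
    ...   | inj₂ ikj = no (L-asym ikj)
    L? i j k | yes i≡j | _ | _ = no λ ijk → L⇒≢ (L-cyclic (L-cyclic ijk)) i≡j
    L? i j k | no _ | yes j≡k | _ = no λ ijk → L⇒≢ ijk j≡k
    L? i j k | no _ | no _ | yes i≡k = no λ ijk → L⇒≢ (L-cyclic ijk) (≡.sym i≡k)

    -- The separating line passes through two points of the set, so a finite search decides the
    -- relation. It implies disjointness, and walks in `D P` are built from such pairs.
    Separated : Rel (Fin n × Fin n) _
    Separated (a , b) (c , d) = ∃₂ λ u v → OnOrRight L u v a × OnOrRight L u v b × L u v c × L u v d

    OnOrRight? : ∀ u v a → Dec (OnOrRight L u v a)
    OnOrRight? u v a = (a Fin.≟ u) ⊎-dec (a Fin.≟ v) ⊎-dec L? v u a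

    Separated? : Decidable Separated
    Separated? (a , b) (c , d) = Fin.any? λ u → Fin.any? λ v →
      OnOrRight? u v a ×-dec OnOrRight? u v b ×-dec L? u v c ×-dec L? u v d

    onOrRight⇒nonNegative : ∀ u v a → OnOrRight L u v a → NonNegative (orientation (P v) (P u) (P a))
    onOrRight⇒nonNegative u v a (inj₁ refl)        = inj₁ (orientation-degenerate (P v) (P u))
    onOrRight⇒nonNegative u v a (inj₂ (inj₁ refl)) = inj₁ (orientation-degenerate₁ (P v) (P u))
    onOrRight⇒nonNegative u v a (inj₂ (inj₂ vua))  = inj₂ vua

    Separated⇒Disjoint : ∀ {a b c d} → Separated (a , b) (c , d) → Disjoint (P a , P b) (P c , P d)
    Separated⇒Disjoint (u , v , a , b , uvc , uvd) =
      separated⇒disjoint {P u} {P v} (onOrRight⇒nonNegative u v _ a) (onOrRight⇒nonNegative u v _ b) uvc uvd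

    -- i lies strictly to the left of the line through r parallel to pq. A point r with
    -- all others above it is extreme, so L r orders those others linearly.
    Above : Fin n → Fin n → Fin n → Fin n → Set _
    Above p q r i = r ≢ i × 0# < cross (P q ⊖ P p) (P i ⊖ P r)

    -- If instead `L r c a` held, all three products in the Plücker relation would be positive,
    -- while their sum is zero.
    L-trans : ∀ p q r {a b c} → Above p q r a → Above p q r b → Above p q r c → L r a b → L r b c → L r a c
    L-trans p q r {a} {b} {c} (r≢a , va) (_ , vb) (r≢c , vc) rab rbc with L-total r≢a a≢c r≢c
      where
      a≢c : a ≢ c
      a≢c refl = L-asym rab rbc
    ... | inj₁ rac = rac
    ... | inj₂ rca = contradiction (*-positive vc rab) (positive-asym
      (plücker (P q ⊖ P p) (P a ⊖ P r) (P b ⊖ P r) (P c ⊖ P r))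
      (+-positive (inj₂ (*-positive vb rca)) (*-positive va rbc)))

    sortAround : ∀ p q r xs → Unique xs → All (Above p q r) xs → ∃ λ ys → xs ↭ ys × AllPairs (L r) ys
    sortAround p q r = insertionSort
      (λ (r≢x , _) (r≢y , _) x≢y → L-total r≢x x≢y r≢y) (L-trans p q r)

    above : ∀ p q x i → L p x q → NonNegative (orientation (P p) (P q) (P i)) →
            0# < cross (P q ⊖ P p) (P i ⊖ P x)
    above p q x i pxq i≥0 =
      S.<-respʳ-≈ (E.sym (orientation-shift (P p) (P q) (P i) (P x))) (+-positive i≥0 pxq)

    -- Adding a point x to a set with hull edge pq and all other points to its left: if x
    -- is also on the left, pq remains a hull edge, and otherwise x is extreme.
    addLeft : ∀ p q x ys → Unique (p ∷ x ∷ ys) → L p q x → AllPairs (L p) (q ∷ ys) →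
              ∃ λ zs → x ∷ ys ↭ zs × AllPairs (L p) (q ∷ zs)
    addLeft p q x ys (p≢xys ∷ uniq) pqx (pq<ys ∷ _) =
      let zs , xys↭ , sorted = sortAround p q p (x ∷ ys) uniq (All.zip (p≢xys , pqx ∷ pq<ys))
      in zs , xys↭ , All-resp-↭ xys↭ (pqx ∷ pq<ys) ∷ sorted

    addRight : ∀ p q x ys → Unique (x ∷ p ∷ q ∷ ys) → L p x q → AllPairs (L p) (q ∷ ys) →
               ∃ λ zs → p ∷ q ∷ ys ↭ zs × AllPairs (L x) zs
    addRight p q x ys ((x≢p ∷ x≢q ∷ x≢ys) ∷ uniq) pxq (pq<ys ∷ _) =
      sortAround p q x (p ∷ q ∷ ys) uniq
        ((x≢p , above p q x p pxq (inj₁ (orientation-degenerate₁ (P p) (P q)))) ∷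
         (x≢q , above p q x q pxq (inj₁ (orientation-degenerate (P p) (P q)))) ∷
         All.zipWith (λ {i} (x≢i , pqi) → x≢i , above p q x i pxq (inj₂ pqi)) (x≢ys , pq<ys))

    -- Orientations are decidable but coordinates need not be comparable, so an extreme point is
    -- maintained incrementally rather than chosen as lowest. The head `q` of the sorted list always
    -- gives a hull edge `pq`.
    arrange : ∀ x xs → Unique (x ∷ xs) → ∃₂ λ p ys → x ∷ xs ↭ p ∷ ys × AllPairs (L p) ys
    arrange x [] _ = x , [] , refl , []
    arrange x (x′ ∷ xs) (x≢xs ∷ uniq) with arrange x′ xs uniq
    ... | p , [] , xs↭ , _ = x , [ p ] , prep x xs↭ , [] ∷ []
    ... | p , q ∷ ys , xs↭ , sorted
      with x≢pqys@(x≢p ∷ x≢q ∷ x≢ys) ← All-resp-↭ xs↭ x≢xs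
      with uniq′@((p≢q ∷ p≢ys) ∷ q≢ys ∷ uniq-ys) ← Unique-resp-↭ xs↭ uniq
      with L-total p≢q (x≢q ∘ ≡.sym) (x≢p ∘ ≡.sym)
    ... | inj₁ pqx =
      let zs , xys↭ , sorted′ = addLeft p q x ys (((x≢p ∘ ≡.sym) ∷ p≢ys) ∷ x≢ys ∷ uniq-ys) pqx sorted
      in p , q ∷ zs ,
         ↭-trans (prep x xs↭) (↭-trans (swap x p refl) (prep p (↭-trans (swap x q refl) (prep q xys↭)))) ,
         sorted′
    ... | inj₂ pxq =
      let zs , pqys↭ , sorted′ = addRight p q x ys (x≢pqys ∷ uniq′) pxq sorted
      in x , zs , ↭-trans (prep x xs↭) (prep x pqys↭) , sorted′

-- Arithmetic of the bound.

open import Data.Nat.Base using (_+_; _∸_; _≤_; _<_; ⌊_/2⌋; ⌈_/2⌉)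

private variable
  a r s : Level
  A : Set a
  x y z : A
  xs ys zs : List A

bound : ℕ → ℕ
bound m = ⌊ m /2⌋ C 2 + ⌈ m /2⌉ C 2

+-leftSwap : ∀ a b c → a + (b + c) ≡ b + (a + c)
+-leftSwap = solve 3 (λ a b c → a :+ (b :+ c) := b :+ (a :+ c)) refl
  where open +-*-Solver

suc-C-2 : ∀ k → suc k C 2 ≡ k + k C 2
suc-C-2 k = ≡.trans (sym (nCk+nC[k+1]≡[n+1]C[k+1] k 1)) (cong (_+ k C 2) (nC1≡n k))

-- The halves of `suc m` are `⌈ m /2⌉` and `suc ⌊ m /2⌋`, so only one of the two binomials changes.
bound-suc : ∀ m → bound (suc m) ≡ ⌊ m /2⌋ + bound m
bound-suc m rewrite suc-C-2 ⌊ m /2⌋ =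
  solve 3 (λ h x y → y :+ (h :+ x) := h :+ (x :+ y)) refl ⌊ m /2⌋ (⌊ m /2⌋ C 2) (⌈ m /2⌉ C 2)
  where open +-*-Solver

bound-suc-suc : ∀ m → bound (suc (suc m)) ≡ m + bound m
bound-suc-suc m = begin
  bound (suc (suc m))                      ≡⟨ bound-suc (suc m) ⟩
  ⌈ m /2⌉ + bound (suc m)                  ≡⟨ cong (⌈ m /2⌉ +_) (bound-suc m) ⟩
  ⌈ m /2⌉ + (⌊ m /2⌋ + bound m)            ≡⟨ sym (ℕ.+-assoc ⌈ m /2⌉ _ _) ⟩
  ⌈ m /2⌉ + ⌊ m /2⌋ + bound m              ≡⟨ cong (_+ bound m) (ℕ.+-comm ⌈ m /2⌉ _) ⟩
  ⌊ m /2⌋ + ⌈ m /2⌉ + bound m              ≡⟨ cong (_+ bound m) (ℕ.⌊n/2⌋+⌈n/2⌉≡n m) ⟩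
  m + bound m                              ∎
  where open ≡.≡-Reasoning

bound≤C2 : ∀ b → bound b ≤ b C 2
bound≤C2 zero = z≤n
bound≤C2 (suc zero) = z≤n
bound≤C2 (suc (suc b)) = begin
  bound (suc (suc b))  ≡⟨ bound-suc-suc b ⟩
  b + bound b          ≤⟨ ℕ.+-monoʳ-≤ b (bound≤C2 b) ⟩
  b + b C 2            ≡⟨ sym (suc-C-2 b) ⟩
  suc b C 2            ≤⟨ ℕ.m≤n+m _ (suc b) ⟩
  suc b + suc b C 2    ≡⟨ sym (suc-C-2 (suc b)) ⟩
  suc (suc b) C 2      ∎
  where open ℕ.≤-Reasoning

+-interchange : ∀ a b c d → a + b + (c + d) ≡ a + c + (b + d)
+-interchange = solve 4 (λ a b c d → a :+ b :+ (c :+ d) := a :+ c :+ (b :+ d)) refl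
  where open +-*-Solver

-- Taking one element from each part lowers both sides by the same amount `a + b`. Once a part is
-- empty, `bound≤C2` applies.
bound≤C2+C2 : ∀ a b → bound (a + b) ≤ a C 2 + b C 2
bound≤C2+C2 zero b = bound≤C2 b
bound≤C2+C2 (suc a) zero rewrite ℕ.+-comm a 0 | ℕ.+-comm (suc a C 2) 0 = bound≤C2 (suc a)
bound≤C2+C2 (suc a) (suc b) rewrite ℕ.+-suc a b | suc-C-2 a | suc-C-2 b = begin
  bound (suc (suc (a + b)))      ≡⟨ bound-suc-suc (a + b) ⟩
  a + b + bound (a + b)          ≤⟨ ℕ.+-monoʳ-≤ (a + b) (bound≤C2+C2 a b) ⟩
  a + b + (a C 2 + b C 2)        ≡⟨ +-interchange a b (a C 2) (b C 2) ⟩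
  a + a C 2 + (b + b C 2)        ∎
  where open ℕ.≤-Reasoning

bound-step : ∀ m → bound (suc m ∸ 2) ≤ ⌊ m ∸ 2 /2⌋ + bound (m ∸ 2)
bound-step zero          = z≤n
bound-step (suc zero)    = z≤n
bound-step (suc (suc m)) = ℕ.≤-reflexive (bound-suc m)

-- Permutations, sublists and pairwise relations on lists.

⊆⇒↭++ : xs ⊆ ys → ∃ λ zs → ys ↭ xs ++ zs
⊆⇒↭++ []             = [] , refl
⊆⇒↭++ {xs = xs} (y ∷ʳ xs⊆ys) with zs , ys↭ ← ⊆⇒↭++ xs⊆ys =
  y ∷ zs , ↭-trans (prep y ys↭) (↭-sym (shift y xs zs))
⊆⇒↭++ (refl ∷ xs⊆ys) with zs , ys↭ ← ⊆⇒↭++ xs⊆ys = zs , prep _ ys↭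

∈⇒↭∷ : x ∈ xs → ∃ λ ys → xs ↭ x ∷ ys
∈⇒↭∷ x∈xs with ys , zs , refl ← ∈-∃++ x∈xs = ys ++ zs , shift _ ys zs

split : ∀ {P : U.Pred A r} {Q : U.Pred A s} → All (λ x → P x ⊎ Q x) xs →
        ∃₂ λ ys zs → xs ↭ ys ++ zs × All P ys × All Q zs
split [] = [] , [] , refl , [] , []
split {xs = x ∷ xs} (p⊎q ∷ all) with ys , zs , xs↭ , pys , qzs ← split all | p⊎q
... | inj₁ p = x ∷ ys , zs , prep x xs↭ , p ∷ pys , qzs
... | inj₂ q = ys , x ∷ zs , ↭-trans (prep x xs↭) (↭-sym (shift x ys zs)) , pys , q ∷ qzs

length-filter-∁ : ∀ {P : U.Pred A r} (P? : U.Decidable P) xs →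
                  length (filter P? xs) + length (filter (¬? ∘ P?) xs) ≡ length xs
length-filter-∁ P? [] = refl
length-filter-∁ P? (x ∷ xs) with P? x
... | yes _ = cong suc (length-filter-∁ P? xs)
... | no  _ = ≡.trans (ℕ.+-suc _ _) (cong suc (length-filter-∁ P? xs))

length-filter-≢ : ∀ (x : A) (x≟_ : U.Decidable (x ≡_)) → Unique xs →
                  length xs ≤ suc (length (filter (¬? ∘ x≟_) xs))
length-filter-≢ x x≟_ [] = z≤n
length-filter-≢ x x≟_ (_∷_ {y} {ys} y≢ys uniq) with x≟ y
... | yes refl = s≤s (ℕ.≤-reflexive (sym (cong length (filter-all (¬? ∘ x≟_) y≢ys))))
... | no _     = s≤s (length-filter-≢ x x≟_ uniq)

module _ {R : Rel A r} where

  AllPairs-++⁻ʳ : ∀ xs → AllPairs R (xs ++ ys) → AllPairs R ys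
  AllPairs-++⁻ʳ []       rs       = rs
  AllPairs-++⁻ʳ (x ∷ xs) (_ ∷ rs) = AllPairs-++⁻ʳ xs rs

  AllPairs-++⁻ˡ : ∀ xs → AllPairs R (xs ++ ys) → AllPairs R xs
  AllPairs-++⁻ˡ []       rs        = []
  AllPairs-++⁻ˡ (x ∷ xs) (x~ ∷ rs) = All.++⁻ˡ xs x~ ∷ AllPairs-++⁻ˡ xs rs

  AllPairs-around : ∀ xs → AllPairs R (xs ++ y ∷ ys) → All (flip R y) xs × All (R y) ys
  AllPairs-around []       (y~ys ∷ _) = [] , y~ys
  AllPairs-around (x ∷ xs) (x~ ∷ rs) with xs~y , y~ys ← AllPairs-around xs rs =
    All.lookup x~ (∈-++⁺ʳ xs (here refl)) ∷ xs~y , y~ys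

  AllPairs-lookup : Symmetric R → AllPairs R xs → x ∈ xs → y ∈ xs → x ≢ y → R x y
  AllPairs-lookup R-sym (_ ∷ _)   (here refl) (here refl) x≢y = contradiction refl x≢y
  AllPairs-lookup R-sym (x~ ∷ _)  (here refl) (there y∈)  x≢y = All.lookup x~ y∈
  AllPairs-lookup R-sym (y~ ∷ _)  (there x∈)  (here refl) x≢y = R-sym (All.lookup y~ x∈)
  AllPairs-lookup R-sym (_ ∷ rs)  (there x∈)  (there y∈)  x≢y = AllPairs-lookup R-sym rs x∈ y∈ x≢y

  -- By asymmetry, `R` between members of the list can only follow their order in it, and that order
  -- is transitive.
  AllPairs-trans : (∀ {x y} → R x y → ¬ R y x) → AllPairs R xs →
                   x ∈ xs → y ∈ xs → z ∈ xs → R x y → R y z → R x z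
  AllPairs-trans asym (_ ∷ rs)  (there x∈)  (there y∈)  (there z∈)  p q = AllPairs-trans asym rs x∈ y∈ z∈ p q
  AllPairs-trans asym (x~ ∷ _)  (here refl) y∈          (there z∈)  p q = All.lookup x~ z∈
  AllPairs-trans asym (x~ ∷ _)  (here refl) y∈          (here refl) p q = contradiction q (asym p)
  AllPairs-trans asym (y~ ∷ _)  (there x∈)  (here refl) z∈          p q = contradiction p (asym (All.lookup y~ x∈))
  AllPairs-trans asym (z~ ∷ _)  (there x∈)  (there y∈)  (here refl) p q = contradiction q (asym (All.lookup z~ y∈))

  findPair : ∀ {S : Rel A s} → Decidable S → AllPairs R xs →
             AllPairs S xs ⊎ ∃₂ λ x y → x ∈ xs × y ∈ xs × R x y × ¬ S x y
  findPair S? [] = inj₁ []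
  findPair S? (_∷_ {x} {xs} x~ rs) with any? (¬? ∘ S? x) xs | findPair S? rs
  ... | yes any | _ with y , y∈ , ¬s ← find any =
    inj₂ (x , y , here refl , there y∈ , All.lookup x~ y∈ , ¬s)
  ... | no _    | inj₂ (y , z , y∈ , z∈ , r , ¬s) = inj₂ (y , z , there y∈ , there z∈ , r , ¬s)
  ... | no ¬any | inj₁ ss =
    inj₁ (All.map (λ {y} → decidable-stable (S? x y)) (All.¬Any⇒All¬ xs ¬any) ∷ ss)

-- Counting deleted segments in an abstract configuration.

-- L a b c says that a, b, c make a left turn, and M a b that the segment ab is deleted.
module Colouring {ℓ : Level} {V : Set} (_≟_ : DecidableEquality V)
  (L : V → V → V → Set ℓ)
  (L-total : ∀ {a b c} → a ≢ b → b ≢ c → a ≢ c → L a b c ⊎ L a c b)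
  (L-asym : ∀ {a b c} → L a b c → ¬ L a c b)
  (L-cyclic : ∀ {a b c} → L a b c → L b c a)
  (arrange : ∀ x xs → Unique (x ∷ xs) →
             ∃₂ λ p ys → x ∷ xs ↭ p ∷ ys × AllPairs (L p) ys)
  {m : Level} (M : V → V → Set m) (M? : Decidable M) (M-sym : Symmetric M)
  (colour : V → V → Bool) (colour-sym : ∀ a b → colour a b ≡ colour b a)
  (colour-closed : ∀ {u v a b c d} →
     OnOrRight L u v a → OnOrRight L u v b → L u v c → L u v d →
     a ≢ b → c ≢ d → ¬ M a b → ¬ M c d → colour a b ≡ colour c d)
  where

  missing : V → List V → ℕ
  missing x = length ∘ filter (M? x)

  totalMissing : List V → ℕ
  totalMissing []       = 0
  totalMissing (x ∷ xs) = missing x xs + totalMissing xs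

  missing-↭ : ∀ x → xs ↭ ys → missing x xs ≡ missing x ys
  missing-↭ x xs↭ys = ↭-length (filter-↭ (M? x) xs↭ys)

  missing-++ : ∀ x xs ys → missing x (xs ++ ys) ≡ missing x xs + missing x ys
  missing-++ x xs ys = ≡.trans (cong length (filter-++ (M? x) xs ys)) (length-++ (filter (M? x) xs))

  missing-all : All (M x) xs → missing x xs ≡ length xs
  missing-all {x} ms = cong length (filter-all (M? x) ms)

  totalMissing-swap : ∀ x y xs → totalMissing (x ∷ y ∷ xs) ≡ totalMissing (y ∷ x ∷ xs)
  totalMissing-swap x y xs with M? x y | M? y x
  ... | yes _ | yes _ = cong suc (+-leftSwap (missing x xs) (missing y xs) _)
  ... | no ¬m | yes m = contradiction (M-sym m) ¬m
  ... | yes m | no ¬m = contradiction (M-sym m) ¬m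
  ... | no _  | no _  = +-leftSwap (missing x xs) (missing y xs) _

  totalMissing-↭ : xs ↭ ys → totalMissing xs ≡ totalMissing ys
  totalMissing-↭ refl = refl
  totalMissing-↭ (prep x p) = cong₂ _+_ (missing-↭ x p) (totalMissing-↭ p)
  totalMissing-↭ (swap {xs} x y p) = ≡.trans (totalMissing-swap x y xs)
    (cong₂ _+_ (missing-↭ y (prep x p)) (cong₂ _+_ (missing-↭ x p) (totalMissing-↭ p)))
  totalMissing-↭ (trans p q) = ≡.trans (totalMissing-↭ p) (totalMissing-↭ q)

  totalMissing-++ : ∀ xs ys → totalMissing xs + totalMissing ys ≤ totalMissing (xs ++ ys)
  totalMissing-++ []       ys = ℕ.≤-refl
  totalMissing-++ (x ∷ xs) ys rewrite missing-++ x xs ys = begin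
    missing x xs + totalMissing xs + totalMissing ys                 ≡⟨ ℕ.+-assoc (missing x xs) _ _ ⟩
    missing x xs + (totalMissing xs + totalMissing ys)
      ≤⟨ ℕ.+-mono-≤ (ℕ.m≤m+n (missing x xs) (missing x ys)) (totalMissing-++ xs ys) ⟩
    missing x xs + missing x ys + totalMissing (xs ++ ys)            ∎
    where open ℕ.≤-Reasoning

  Independent : List V → Set _
  Independent = AllPairs M

  totalMissing-independent : Independent xs → totalMissing xs ≡ length xs C 2
  totalMissing-independent [] = refl
  totalMissing-independent {x ∷ xs} (ms ∷ ind) = ≡.trans
    (cong₂ _+_ (missing-all ms) (totalMissing-independent ind)) (sym (suc-C-2 (length xs)))

  Few : List V → Set
  Few xs = totalMissing xs < bound (length xs ∸ 2)

  Few-↭ : xs ↭ ys → Few xs → Few ys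
  Few-↭ xs↭ys rewrite totalMissing-↭ xs↭ys | ↭-length xs↭ys = id

  -- The points `u` and `v` account for the `∸ 2` in `Few`. By `bound≤C2+C2`, the pairs inside `A`
  -- and inside `B` alone already reach the bound.
  ¬Few-independent : ∀ {u v} A {B} → Independent A → Independent B → xs ↭ u ∷ v ∷ A ++ B → ¬ Few xs
  ¬Few-independent {u = u} {v} A {B} indA indB xs↭ few = ℕ.<-irrefl refl (begin-strict
    totalMissing (A ++ B)                                      ≤⟨ ℕ.m≤n+m _ (missing v (A ++ B)) ⟩
    totalMissing (v ∷ A ++ B)                                  ≤⟨ ℕ.m≤n+m _ (missing u (v ∷ A ++ B)) ⟩
    totalMissing (u ∷ v ∷ A ++ B)                              <⟨ Few-↭ xs↭ few ⟩
    bound (length (A ++ B))                                    ≡⟨ cong bound (length-++ A) ⟩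
    bound (length A + length B)                                ≤⟨ bound≤C2+C2 (length A) (length B) ⟩
    length A C 2 + length B C 2
      ≡⟨ sym (cong₂ _+_ (totalMissing-independent indA) (totalMissing-independent indB)) ⟩
    totalMissing A + totalMissing B                            ≤⟨ totalMissing-++ A B ⟩
    totalMissing (A ++ B)                                      ∎)
    where open ℕ.≤-Reasoning

  Edge : V → V → Set _
  Edge a b = a ≢ b × ¬ M a b

  Edge-sym : Symmetric Edge
  Edge-sym (a≢b , ¬m) = a≢b ∘ sym , ¬m ∘ M-sym

  Monochrome : List V → Set _
  Monochrome xs = ∃ λ k → ∀ {a b} → a ∈ xs → b ∈ xs → Edge a b → colour a b ≡ k

  Monochrome-↭ : xs ↭ ys → Monochrome xs → Monochrome ys
  Monochrome-↭ xs↭ys (k , mono) =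
    k , λ a∈ b∈ → mono (∈-resp-↭ (↭-sym xs↭ys) a∈) (∈-resp-↭ (↭-sym xs↭ys) b∈)

  -- Separated edges and the removal of one point.

  L⇒≢ : ∀ {a b c} → L a b c → b ≢ c
  L⇒≢ l refl = L-asym l l

  left-of : ∀ {u v a b c d} → OnOrRight L u v a → OnOrRight L u v b → L u v c → L u v d →
            Edge a b → Edge c d → colour a b ≡ colour c d
  left-of a b c d (a≢b , ¬mab) (c≢d , ¬mcd) = colour-closed a b c d a≢b c≢d ¬mab ¬mcd

  -- The line `xa` splits the remaining points into `A` and `B`. If neither side spanned a surviving
  -- segment, `x` and `a` would be the two exceptional points of `¬Few-independent`.
  disjoint-edge : ∀ {x a xs} → Unique (x ∷ xs) → Few (x ∷ xs) → a ∈ xs → Edge x a →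
                  ∃₂ λ b c → b ∈ xs × c ∈ xs × Edge b c × colour x a ≡ colour b c
  disjoint-edge {x} {a} {xs} uniq few a∈xs xa
    with ys , xs↭ ← ∈⇒↭∷ a∈xs
    with (_ ∷ x≢ys) ∷ a≢ys ∷ uniq-ys ← Unique-resp-↭ (prep x xs↭) uniq
    with A , B , ys↭ , left , right ← split (All.zipWith
           (λ { (x≢y , a≢y) → L-total (proj₁ xa) a≢y x≢y }) (x≢ys , a≢ys))
    with uniq-AB ← Unique-resp-↭ ys↭ uniq-ys
    with xs↭AB ← ↭-trans xs↭ (prep a ys↭)
    with findPair M? (AllPairs-++⁻ˡ A uniq-AB) | findPair M? (AllPairs-++⁻ʳ A uniq-AB)
  ... | inj₁ indA | inj₁ indB = contradiction few (¬Few-independent A indA indB (prep x xs↭AB))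
  ... | inj₂ (b , c , b∈ , c∈ , bc) | _ =
    b , c , within (∈-++⁺ˡ b∈) , within (∈-++⁺ˡ c∈) , bc ,
    left-of (inj₁ refl) (inj₂ (inj₁ refl)) (All.lookup left b∈) (All.lookup left c∈) xa bc
    where
    within : ∀ {y} → y ∈ A ++ B → y ∈ xs
    within y∈ = ∈-resp-↭ (↭-sym xs↭AB) (there y∈)
  ... | inj₁ _ | inj₂ (b , c , b∈ , c∈ , bc) =
    b , c , within (∈-++⁺ʳ A b∈) , within (∈-++⁺ʳ A c∈) , bc ,
    left-of (inj₂ (inj₁ refl)) (inj₁ refl) (turn b∈) (turn c∈) xa bc
    where
    within : ∀ {y} → y ∈ A ++ B → y ∈ xs
    within y∈ = ∈-resp-↭ (↭-sym xs↭AB) (there y∈)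
    turn : ∀ {y} → y ∈ B → L a x y
    turn y∈ = L-cyclic (L-cyclic (All.lookup right y∈))

  Monochrome-∷ : Unique (x ∷ xs) → Few (x ∷ xs) → Monochrome xs → Monochrome (x ∷ xs)
  Monochrome-∷ {x} {xs} uniq few (k , mono) = k , mono′
    where
    at-x : ∀ {a} → a ∈ xs → Edge x a → colour x a ≡ k
    at-x a∈ xa with b , c , b∈ , c∈ , bc , same ← disjoint-edge uniq few a∈ xa =
      ≡.trans same (mono b∈ c∈ bc)

    mono′ : ∀ {a b} → a ∈ x ∷ xs → b ∈ x ∷ xs → Edge a b → colour a b ≡ k
    mono′ (here refl) (here refl) ab = contradiction refl (proj₁ ab)
    mono′ (here refl) (there b∈)  ab = at-x b∈ ab
    mono′ (there a∈)  (here refl) ab = ≡.trans (colour-sym _ _) (at-x a∈ (Edge-sym ab))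
    mono′ (there a∈)  (there b∈)  ab = mono a∈ b∈ ab

  -- By `bound-step` the bound drops by at most `⌊ length xs ∸ 2 /2⌋` when `x` is removed, and at
  -- least as many deleted segments disappear with `x`.
  Few-tail : ∀ x xs → ⌊ length xs ∸ 2 /2⌋ ≤ missing x xs → Few (x ∷ xs) → Few xs
  Few-tail x xs many few = ℕ.+-cancelˡ-< ⌊ length xs ∸ 2 /2⌋ _ _ (begin-strict
    ⌊ length xs ∸ 2 /2⌋ + totalMissing xs        ≤⟨ ℕ.+-monoˡ-≤ _ many ⟩
    missing x xs + totalMissing xs               <⟨ few ⟩
    bound (suc (length xs) ∸ 2)                  ≤⟨ bound-step (length xs) ⟩
    ⌊ length xs ∸ 2 /2⌋ + bound (length xs ∸ 2)  ∎)
    where open ℕ.≤-Reasoning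

  -- A scan with accumulator `A`: it stops at the first `t` joined by a surviving segment to some
  -- earlier `a`, so the points preceding `t` are still independent.
  independent-prefix : ∀ A rest → Independent A → Independent (A ++ rest) ⊎
    ∃₂ λ A′ t → ∃₂ λ B a → A ++ rest ≡ A′ ++ t ∷ B × Independent A′ × a ∈ A′ × ¬ M a t
  independent-prefix A [] ind = inj₁ (subst Independent (sym (++-identityʳ A)) ind)
  independent-prefix A (t ∷ B) ind with any? (λ a → ¬? (M? a t)) A
  ... | yes any with a , a∈ , ¬m ← find any = inj₂ (A , t , B , a , refl , ind , a∈ , ¬m)
  ... | no ¬any = subst (λ zs → Independent zs ⊎ ∃₂ λ A′ t → ∃₂ λ B a →
                           zs ≡ A′ ++ t ∷ B × Independent A′ × a ∈ A′ × ¬ M a t)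
    (++-assoc A [ t ] B)
    (independent-prefix (A ++ [ t ]) B (AllPairs.++⁺ ind ([] ∷ [])
      (All.map (λ m → m ∷ []) (All.map (λ {a} → decidable-stable (M? a t)) (All.¬Any⇒All¬ A ¬any)))))

  -- The separator is the line `pt`, directed from `t` to `p` so that its right side consists of the
  -- points after `t`; the strict side, holding `cd`, is the one before `t`. In `after` the
  -- direction and the two sides are reversed.
  before : ∀ {p t a b c d} → a ≡ p ⊎ a ≡ t ⊎ L p t a → b ≡ p ⊎ b ≡ t ⊎ L p t b →
           L p c t → L p d t → Edge a b → Edge c d → colour a b ≡ colour c d
  before {p} {t} a b c d = left-of (weak a) (weak b) (L-cyclic (L-cyclic c)) (L-cyclic (L-cyclic d))
    where
    weak : ∀ {a} → a ≡ p ⊎ a ≡ t ⊎ L p t a → OnOrRight L t p a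
    weak (inj₁ a≡p)        = inj₂ (inj₁ a≡p)
    weak (inj₂ (inj₁ a≡t)) = inj₁ a≡t
    weak (inj₂ (inj₂ l))   = inj₂ (inj₂ l)

  after : ∀ {p t a b c d} → a ≡ p ⊎ a ≡ t ⊎ L p a t → b ≡ p ⊎ b ≡ t ⊎ L p b t →
          L p t c → L p t d → Edge a b → Edge c d → colour a b ≡ colour c d
  after {p} {t} a b = left-of (weak a) (weak b)
    where
    weak : ∀ {a} → a ≡ p ⊎ a ≡ t ⊎ L p a t → OnOrRight L p t a
    weak (inj₁ a≡p)        = inj₁ a≡p
    weak (inj₂ (inj₁ a≡t)) = inj₂ (inj₁ a≡t)
    weak (inj₂ (inj₂ l))   = inj₂ (inj₂ (L-cyclic (L-cyclic l)))

  -- Angular order around an extreme point.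

  module Extreme {p : V} {ys : List V} (uniq : Unique (p ∷ ys)) (few : Few (p ∷ ys))
                 (sorted : AllPairs (L p) ys) where

    L-total-at-p : ∀ {a b} → a ∈ ys → b ∈ ys → a ≢ b → L p a b ⊎ L p b a
    L-total-at-p a∈ b∈ a≢b =
      L-total (All.lookup (AllPairs.head uniq) a∈) a≢b (All.lookup (AllPairs.head uniq) b∈)

    L-trans-at-p : ∀ {a b c} → a ∈ ys → b ∈ ys → c ∈ ys → L p a b → L p b c → L p a c
    L-trans-at-p = AllPairs-trans L-asym sorted

    -- Besides `at`, there is a surviving `bc` beyond `t`, since otherwise `p` and `t` would be
    -- exceptional points for `A` and `B`. If `t` is at or after `y`, both `px` and `py` agree with
    -- `bc`; if `t` is before `x`, both agree with `at`; in between, `px` agrees with `bc`, `bc`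
    -- with `at`, and `at` with `py`.
    same-colour-ordered : ∀ {x y} → x ∈ ys → y ∈ ys → L p x y → Edge p x → Edge p y →
                          colour p x ≡ colour p y
    same-colour-ordered {x} {y} x∈ y∈ x<y px py with independent-prefix [] ys []
    -- Matching on the membership of `x` only exposes a head of `ys`; that head and `p` are the two
    -- exceptional points.
    same-colour-ordered {x} {y} (here _) y∈ x<y px py | inj₁ (_ ∷ ind) =
      contradiction few (¬Few-independent [] [] ind ↭-refl)
    same-colour-ordered {x} {y} (there _) y∈ x<y px py | inj₁ (_ ∷ ind) =
      contradiction few (¬Few-independent [] [] ind ↭-refl)
    same-colour-ordered {x} {y} x∈ y∈ x<y px py | inj₂ (A , t , B , a , refl , indA , a∈A , ¬mat)
      with A<t , t<B ← AllPairs-around A sorted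
      with findPair M? (AllPairs.tail (AllPairs-++⁻ʳ A sorted))
    ... | inj₁ indB = contradiction few (¬Few-independent A indA indB (prep p (shift t A B)))
    ... | inj₂ (b , c , b∈ , c∈ , b<c , ¬mbc) = same (t ≟ x) (t ≟ y)
      where
      a<t = All.lookup A<t a∈A
      t<b = All.lookup t<B b∈
      t<c = All.lookup t<B c∈
      t∈ = ∈-++⁺ʳ A (here refl)
      a∈′ = ∈-++⁺ˡ a∈A
      b∈′ = ∈-++⁺ʳ A (there b∈)
      c∈′ = ∈-++⁺ʳ A (there c∈)

      at : Edge a t
      at = L⇒≢ a<t , ¬mat

      bc : Edge b c
      bc = L⇒≢ b<c , ¬mbc

      at~bc : colour a t ≡ colour b c
      at~bc = after (inj₂ (inj₂ a<t)) (inj₂ (inj₁ refl)) t<b t<c at bc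

      px~bc : L p x b → L p x c → colour p x ≡ colour b c
      px~bc x<b x<c = after (inj₁ refl) (inj₂ (inj₁ refl)) x<b x<c px bc

      py~bc : L p y b → L p y c → colour p y ≡ colour b c
      py~bc y<b y<c = after (inj₁ refl) (inj₂ (inj₁ refl)) y<b y<c py bc

      py~at : L p t y → colour p y ≡ colour a t
      py~at t<y = before (inj₁ refl) (inj₂ (inj₁ refl)) (L-trans-at-p a∈′ t∈ y∈ a<t t<y) t<y py at

      px~at : L p t x → colour p x ≡ colour a t
      px~at t<x = before (inj₁ refl) (inj₂ (inj₁ refl)) (L-trans-at-p a∈′ t∈ x∈ a<t t<x) t<x px at

      t≥y : L p y b → L p y c → colour p x ≡ colour p y
      t≥y y<b y<c = ≡.trans
        (px~bc (L-trans-at-p x∈ y∈ b∈′ x<y y<b) (L-trans-at-p x∈ y∈ c∈′ x<y y<c))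
        (sym (py~bc y<b y<c))

      x≤t<y : L p x b → L p x c → L p t y → colour p x ≡ colour p y
      x≤t<y x<b x<c t<y = ≡.trans (px~bc x<b x<c) (≡.trans (sym at~bc) (sym (py~at t<y)))

      same : Dec (t ≡ x) → Dec (t ≡ y) → colour p x ≡ colour p y
      same _ (yes refl) = t≥y t<b t<c
      same (yes refl) _ = x≤t<y t<b t<c x<y
      same (no t≢x) (no t≢y) with L-total-at-p t∈ x∈ t≢x | L-total-at-p t∈ y∈ t≢y
      ... | inj₁ t<x | _        = ≡.trans (px~at t<x) (sym (py~at (L-trans-at-p t∈ x∈ y∈ t<x x<y)))
      ... | inj₂ x<t | inj₁ t<y =
        x≤t<y (L-trans-at-p x∈ t∈ b∈′ x<t t<b) (L-trans-at-p x∈ t∈ c∈′ x<t t<c) t<y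
      ... | inj₂ x<t | inj₂ y<t = t≥y (L-trans-at-p y∈ t∈ b∈′ y<t t<b) (L-trans-at-p y∈ t∈ c∈′ y<t t<c)

    same-colour : ∀ {x y} → x ∈ ys → y ∈ ys → Edge p x → Edge p y → colour p x ≡ colour p y
    same-colour {x} {y} x∈ y∈ px py with x ≟ y
    ... | yes refl = refl
    ... | no x≢y with L-total-at-p x∈ y∈ x≢y
    ...   | inj₁ x<y = same-colour-ordered x∈ y∈ x<y px py
    ...   | inj₂ y<x = sym (same-colour-ordered y∈ x∈ y<x py px)

    neighbours : List V
    neighbours = filter (¬? ∘ M? p) ys

    neighbour : x ∈ neighbours → x ∈ ys × Edge p x
    neighbour x∈ with x∈ys , ¬m ← ∈-filter⁻ (¬? ∘ M? p) x∈ =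
      x∈ys , All.lookup (AllPairs.head uniq) x∈ys , ¬m

    module _ {k : Bool} (at-p : ∀ {x} → x ∈ ys → Edge p x → colour p x ≡ k) where

      module Contrast {c d : V} (c∈ : c ∈ ys) (d∈ : d ∈ ys) (c<d : L p c d) (cd : Edge c d)
                      (cd≢k : colour c d ≢ k) where

        -- A point `x` before `c` is also before `d`, so the line `px` would separate `px` from `cd`
        -- and give `cd` the colour `k`.
        ¬before : x ∈ ys → Edge p x → ¬ L p x c
        ¬before x∈ px x<c = cd≢k (≡.trans
          (sym (after (inj₁ refl) (inj₂ (inj₁ refl)) x<c (L-trans-at-p x∈ c∈ d∈ x<c c<d) px cd))
          (at-p x∈ px))

        -- The point `p` lies to the left of the directed line `cd`. If `x` did too, that line would
        -- separate `cd` from `px`.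
        beyond : x ∈ ys → Edge p x → c ≢ x → d ≢ x → L d c x
        beyond x∈ px c≢x d≢x with L-total (proj₁ cd) d≢x c≢x
        ... | inj₂ cxd = L-cyclic (L-cyclic cxd)
        ... | inj₁ cdx = contradiction
          (≡.trans (left-of (inj₁ refl) (inj₂ (inj₁ refl)) (L-cyclic c<d) cdx cd px) (at-p x∈ px)) cd≢k

        others : List V
        others = filter (λ x → ¬? (c ≟ x)) (filter (λ x → ¬? (d ≟ x)) neighbours)

        others⊆ys : others ⊆ ys
        others⊆ys = ⊆-trans (filter-⊆ _ _) (⊆-trans (filter-⊆ _ _) (filter-⊆ _ ys))

        other : x ∈ others → x ∈ ys × Edge p x × c ≢ x × d ≢ x
        other x∈ with x∈′ , c≢x ← ∈-filter⁻ _ x∈ with x∈″ , d≢x ← ∈-filter⁻ _ x∈′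
          with x∈ys , px ← neighbour x∈″ = x∈ys , px , c≢x , d≢x

        length-others : length neighbours ≤ 2 + length others
        length-others = ℕ.≤-trans (length-filter-≢ d (d ≟_) uniq-nbrs)
          (s≤s (length-filter-≢ c (c ≟_) (AllPairs.filter⁺ _ uniq-nbrs)))
          where
          uniq-nbrs : Unique neighbours
          uniq-nbrs = AllPairs.filter⁺ _ (AllPairs.tail uniq)

        -- By `beyond`, both ends lie strictly across the line `cd` from `p`, so that line separates
        -- `xy` from `cd` and the colours agree.
        other-edge : ∀ {x y} → x ∈ others → y ∈ others → Edge x y → colour x y ≢ k
        other-edge x∈ y∈ xy xy≡k
          with x∈ys , px , c≢x , d≢x ← other x∈ | y∈ys , py , c≢y , d≢y ← other y∈ =
          cd≢k (≡.trans (left-of (inj₂ (inj₁ refl)) (inj₁ refl)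
            (beyond x∈ys px c≢x d≢x) (beyond y∈ys py c≢y d≢y) cd xy) xy≡k)

        others-pair : Independent others ⊎ ∃₂ λ x y → x ∈ others × y ∈ others × L p x y × ¬ M x y
        others-pair = findPair M? (AllPairs.filter⁺ _ (AllPairs.filter⁺ _ (AllPairs.filter⁺ _ sorted)))

      k-or-missing : V → V → Set _
      k-or-missing a b = M a b ⊎ colour a b ≡ k

      k-or-missing? : Decidable k-or-missing
      k-or-missing? a b = M? a b ⊎-dec (colour a b Bool.≟ k)

      k-or-missing-sym : Symmetric k-or-missing
      k-or-missing-sym = Sum.map M-sym (≡.trans (colour-sym _ _))

      -- If xx′ has a colour other than k then all surviving px end between x and x′ in the
      -- angular order, so a second such segment cannot lie inside the first.
      large-independent : Monochrome (p ∷ ys) ⊎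
        ∃ λ zs → zs ⊆ ys × Independent zs × length neighbours ≤ 2 + length zs
      large-independent with findPair k-or-missing? sorted
      ... | inj₁ all = inj₁ (k , mono)
        where
        mono : ∀ {a b} → a ∈ p ∷ ys → b ∈ p ∷ ys → Edge a b → colour a b ≡ k
        mono (here refl) (here refl) ab = contradiction refl (proj₁ ab)
        mono (here refl) (there b∈)  ab = at-p b∈ ab
        mono (there a∈)  (here refl) ab = ≡.trans (colour-sym _ _) (at-p a∈ (Edge-sym ab))
        mono (there a∈)  (there b∈)  (a≢b , ¬m) with AllPairs-lookup k-or-missing-sym all a∈ b∈ a≢b
        ... | inj₁ m  = contradiction m ¬m
        ... | inj₂ eq = eq
      ... | inj₂ (c , d , c∈ , d∈ , c<d , ¬k) = inj₂ (around-cd C.others-pair)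
        where
        module C = Contrast c∈ d∈ c<d (L⇒≢ c<d , ¬k ∘ inj₁) (¬k ∘ inj₂)
        Goal = ∃ λ zs → zs ⊆ ys × Independent zs × length neighbours ≤ 2 + length zs
        HasEdge = λ zs → ∃₂ λ x y → x ∈ zs × y ∈ zs × L p x y × ¬ M x y

        around-cd : Independent C.others ⊎ HasEdge C.others → Goal
        around-cd (inj₁ ind) = C.others , C.others⊆ys , ind , C.length-others
        around-cd (inj₂ (x , x′ , x∈ , x′∈ , x<x′ , ¬m))
          with x∈ys , px , _ ← C.other x∈ | x′∈ys , _ ← C.other x′∈ =
          around-xx′ X.others-pair
          where
          xx′ : Edge x x′
          xx′ = L⇒≢ x<x′ , ¬m
          module X = Contrast x∈ys x′∈ys x<x′ xx′ (C.other-edge x∈ x′∈ xx′)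

          around-xx′ : Independent X.others ⊎ HasEdge X.others → Goal
          around-xx′ (inj₁ ind) = X.others , X.others⊆ys , ind , X.length-others
          around-xx′ (inj₂ (y , z , y∈ , z∈ , y<z , ¬m))
            with y∈ys , py , x≢y , _ ← X.other y∈ | z∈ys , _ ← X.other z∈
            with L-total-at-p x∈ys y∈ys x≢y
          ... | inj₂ y<x = contradiction y<x (X.¬before y∈ys py)
          ... | inj₁ x<y = contradiction x<y (Y.¬before x∈ys px)
            where
            yz : Edge y z
            yz = L⇒≢ y<z , ¬m
            module Y = Contrast y∈ys z∈ys y<z yz (X.other-edge y∈ z∈ yz)

    HighDegree : Set _
    HighDegree = ∃₂ λ z zs → p ∷ ys ↭ z ∷ zs × ⌊ length zs ∸ 2 /2⌋ ≤ missing z zs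

    -- If `p` meets too few deleted segments, it has many neighbours, hence `zs` is large. Any
    -- member of `zs`, here the head, is then joined by deleted segments to all the others in `zs`.
    high-degree : ∀ zs → zs ⊆ ys → Independent zs → length neighbours ≤ 2 + length zs → HighDegree
    high-degree zs zs⊆ys ind large with ⌊ length ys ∸ 2 /2⌋ ℕ.≤? missing p ys
    ... | yes many = p , ys , ↭-refl , many
    ... | no few-p = from zs zs⊆ys ind (arithmetic (length-filter-∁ (M? p) ys) (ℕ.≰⇒> few-p) large)
      where
      -- Here `i` counts the deleted segments at `p`, `j` the surviving ones, and `l` the
      -- independent points. The strict conclusion pays for the chosen point, which is not joined to
      -- itself.
      arithmetic : ∀ {m i j l} → i + j ≡ m → i < ⌊ m ∸ 2 /2⌋ → j ≤ 2 + l → ⌊ m ∸ 2 /2⌋ < l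
      arithmetic {zero} eq () le
      arithmetic {suc zero} eq () le
      arithmetic {suc (suc m)} {i} {j} {l} eq i<h j≤ = ℕ.+-cancelˡ-< h h l (begin-strict
        h + h                ≤⟨ ℕ.+-monoʳ-≤ h (ℕ.⌊n/2⌋≤⌈n/2⌉ m) ⟩
        h + ⌈ m /2⌉          ≡⟨ ℕ.⌊n/2⌋+⌈n/2⌉≡n m ⟩
        m                    ≤⟨ ℕ.≤-pred (ℕ.≤-pred (begin
          2 + m                ≡⟨ sym eq ⟩
          i + j                ≤⟨ ℕ.+-monoʳ-≤ i j≤ ⟩
          i + (2 + l)          ≡⟨ +-leftSwap i 2 l ⟩
          2 + (i + l)          ∎)) ⟩
        i + l                <⟨ ℕ.+-monoˡ-< l i<h ⟩
        h + l                ∎)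
        where
        open ℕ.≤-Reasoning
        h = ⌊ m /2⌋

      from : ∀ zs → zs ⊆ ys → Independent zs → ⌊ length ys ∸ 2 /2⌋ < length zs → HighDegree
      from (z ∷ zs) zs⊆ys (ms ∷ _) h< with rest , ys↭ ← ⊆⇒↭++ zs⊆ys =
        z , p ∷ zs ++ rest , ↭-trans (prep p ys↭) (swap p z refl) , (begin
          ⌊ length (p ∷ zs ++ rest) ∸ 2 /2⌋    ≡⟨ cong (λ n → ⌊ n ∸ 2 /2⌋) (sym (↭-length ys↭)) ⟩
          ⌊ length ys ∸ 2 /2⌋                  ≤⟨ ℕ.≤-pred h< ⟩
          length zs                            ≡⟨ sym (missing-all ms) ⟩
          missing z zs                         ≤⟨ ℕ.m≤m+n _ _ ⟩
          missing z zs + missing z rest        ≡⟨ sym (missing-++ z zs rest) ⟩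
          missing z (zs ++ rest)               ≤⟨ ℕ.m≤n+m _ (missing z [ p ]) ⟩
          missing z [ p ] + missing z (zs ++ rest)  ≡⟨ sym (missing-++ z [ p ] (zs ++ rest)) ⟩
          missing z (p ∷ zs ++ rest)           ∎)
        where open ℕ.≤-Reasoning

    monochrome-or-high-degree : Monochrome (p ∷ ys) ⊎ HighDegree
    monochrome-or-high-degree with any? (¬? ∘ M? p) ys
    ... | yes any with x , x∈ , ¬m ← find any
          with large-independent (λ y∈ py → same-colour y∈ x∈ py (All.lookup (AllPairs.head uniq) x∈ , ¬m))
    ...   | inj₁ mono = inj₁ mono
    ...   | inj₂ (zs , zs⊆ys , ind , large) = inj₂ (high-degree zs zs⊆ys ind large)
    monochrome-or-high-degree | no ¬any = inj₂ (p , ys , ↭-refl , (begin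
      ⌊ length ys ∸ 2 /2⌋   ≤⟨ ℕ.⌊n/2⌋≤n (length ys ∸ 2) ⟩
      length ys ∸ 2         ≤⟨ ℕ.m∸n≤m (length ys) 2 ⟩
      length ys             ≡⟨ sym (missing-all all-missing) ⟩
      missing p ys          ∎))
      where
      open ℕ.≤-Reasoning
      all-missing : All (M p) ys
      all-missing = All.map (λ {x} → decidable-stable (M? p x)) (All.¬Any⇒All¬ ys ¬any)

  -- The length is the induction measure, because the list left after removing `z` is a permuted
  -- remainder and not a structural tail.
  monochrome : ∀ n xs → length xs ≡ n → Unique xs → Few xs → Monochrome xs
  -- `bound 0` is zero, so `Few []` is impossible.
  monochrome _ []       _  _    ()
  monochrome (suc n) (x ∷ xs) eq uniq few
    with p , ys , xs↭ , sorted ← arrange x xs uniq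
    with Extreme.monochrome-or-high-degree (Unique-resp-↭ xs↭ uniq) (Few-↭ xs↭ few) sorted
  ... | inj₁ mono = Monochrome-↭ (↭-sym xs↭) mono
  ... | inj₂ (z , zs , ys↭ , many) =
    Monochrome-↭ (↭-sym xs↭z) (Monochrome-∷ uniq-z few-z
      (monochrome n zs length-zs (AllPairs.tail uniq-z) (Few-tail z zs many few-z)))
    where
    xs↭z = ↭-trans xs↭ ys↭
    uniq-z = Unique-resp-↭ xs↭z uniq
    few-z = Few-↭ xs↭z few
    length-zs : length zs ≡ n
    length-zs = ℕ.suc-injective (≡.trans (sym (↭-length xs↭z)) eq)

-- Walks and two-colourings of a finite graph.

-- Floyd–Warshall: the list holds the vertices allowed strictly inside a walk.
module Reachability {a r : Level} {A : Set a} (_≟_ : DecidableEquality A)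
                    {R : Rel A r} (R? : Decidable R) where

  Reach : List A → Rel A (a Level.⊔ r)
  Reach []       x y = x ≡ y ⊎ R x y
  Reach (z ∷ zs) x y = Reach zs x y ⊎ (Reach zs x z × Reach zs z y)

  Reach? : ∀ zs → Decidable (Reach zs)
  Reach? []       x y = (x ≟ y) ⊎-dec R? x y
  Reach? (z ∷ zs) x y = Reach? zs x y ⊎-dec (Reach? zs x z ×-dec Reach? zs z y)

  Reach⇒Star : ∀ zs {x y} → Reach zs x y → Star R x y
  Reach⇒Star []       (inj₁ refl)       = ε
  Reach⇒Star []       (inj₂ xRy)        = xRy ◅ ε
  Reach⇒Star (z ∷ zs) (inj₁ xy)         = Reach⇒Star zs xy
  Reach⇒Star (z ∷ zs) (inj₂ (xz , zy)) = Reach⇒Star zs xz ◅◅ Reach⇒Star zs zy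

  Reach-weaken : ∀ zs {x y} → x ≡ y ⊎ R x y → Reach zs x y
  Reach-weaken []       p = p
  Reach-weaken (z ∷ zs) p = inj₁ (Reach-weaken zs p)

  -- Loops are cut out: a detour through `y` is dropped when `y` is the head, and when both walks
  -- pass through `w` the part between the two visits is skipped.
  Reach-trans : ∀ zs {x y z} → y ∈ zs → Reach zs x y → Reach zs y z → Reach zs x z
  Reach-trans (y ∷ zs) (here refl) xy yz = inj₂ (toʸ xy , fromʸ yz)
    where
    toʸ : ∀ {x} → Reach (y ∷ zs) x y → Reach zs x y
    toʸ (inj₁ xy)       = xy
    toʸ (inj₂ (xy , _)) = xy
    fromʸ : ∀ {z} → Reach (y ∷ zs) y z → Reach zs y z
    fromʸ (inj₁ yz)       = yz
    fromʸ (inj₂ (_ , yz)) = yz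
  Reach-trans (w ∷ zs) (there y∈) (inj₁ xy)        (inj₁ yz)        = inj₁ (Reach-trans zs y∈ xy yz)
  Reach-trans (w ∷ zs) (there y∈) (inj₁ xy)        (inj₂ (yw , wz)) = inj₂ (Reach-trans zs y∈ xy yw , wz)
  Reach-trans (w ∷ zs) (there y∈) (inj₂ (xw , wy)) (inj₁ yz)        = inj₂ (xw , Reach-trans zs y∈ wy yz)
  Reach-trans (w ∷ zs) (there y∈) (inj₂ (xw , _))  (inj₂ (_ , wz))  = inj₂ (xw , wz)

  -- The indicator of the vertices reachable from `x` is itself a colouring constant along edges. It
  -- is true at `x`, hence also at `y`.
  colourings⇒Star : Symmetric R → ∀ vs → (∀ v → v ∈ vs) → ∀ {x y} →
    (∀ (f : A → Bool) → (∀ {u v} → R u v → f u ≡ f v) → f x ≡ f y) → Star R x y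
  colourings⇒Star R-sym vs all {x} {y} same with Reach? vs x y | same f f-closed
    where
    f : A → Bool
    f v = does (Reach? vs x v)
    step : ∀ {u v} → R u v → Reach vs x u → Reach vs x v
    step uRv xu = Reach-trans vs (all _) xu (Reach-weaken vs (inj₂ uRv))
    f-closed : ∀ {u v} → R u v → f u ≡ f v
    f-closed {u} {v} uRv with Reach? vs x u | Reach? vs x v
    ... | yes _ | yes _ = refl
    ... | no _  | no _  = refl
    ... | yes xu | no ¬xv = contradiction (step uRv xu) ¬xv
    ... | no ¬xu | yes xv = contradiction (step (R-sym uRv) xv) ¬xu
  ... | yes xy | _ = Reach⇒Star vs xy
  ... | no ¬xy | eq with Reach? vs x x
  ...   | no ¬xx = contradiction (Reach-weaken vs (inj₁ refl)) ¬xx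
  ...   | yes _ with () ← eq

lookup-injective : ∀ {a} {A : Set a} {xs : List A} → Unique xs →
                   ∀ i j → lookup xs i ≡ lookup xs j → i ≡ j
lookup-injective (_ ∷ _)    Fin.zero    Fin.zero    _  = refl
lookup-injective (x≢ ∷ _)   Fin.zero    (Fin.suc j) eq = contradiction eq (All.lookup x≢ (∈-lookup j))
lookup-injective (x≢ ∷ _)   (Fin.suc i) Fin.zero    eq = contradiction (sym eq) (All.lookup x≢ (∈-lookup i))
lookup-injective (_ ∷ uniq) (Fin.suc i) (Fin.suc j) eq = cong Fin.suc (lookup-injective uniq i j eq)

length≤∣_∣ : ∀ {n} (W : Subset n) {xs} → Unique xs → All (_∈ₛ W) xs → length xs ≤ ∣ W ∣
length≤∣ W ∣ [] [] = z≤n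
length≤∣ W ∣ (x≢xs ∷ uniq) (x∈W ∷ xs⊆W) = ℕ.≤-<-trans
  (length≤∣ W without _ ∣ uniq (All.zipWith
    (λ (x≢y , y∈W) → x∈p∧x≢y⇒x∈p-y y∈W (x≢y ∘ sym)) (x≢xs , xs⊆W)))
  (x∈p⇒∣p-x∣<∣p∣ x∈W)

-- Connectivity is at most the degree of any vertex.

module _ {a : Level} (H : Graph a) {d : ℕ} where
  open Graph H

  degree<order : ∀ {v} → HasDegree H v d → d < order
  degree<order {v} (N , adj , refl) = subst (∣ N ∣ <_) (∣⊤∣≡n order)
    (p⊂q⇒∣p∣<∣q∣ (⊆-max N , v , ∈⊤ , ~-irrefl ∘ Equivalence.to (adj v)))

  -- If the degree were less than `j`, the neighbourhood `N` could be deleted. A walk leaving `v`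
  -- would have to enter `N` at its first step, yet since `j < order` some vertex other than `v`
  -- remains outside `N`.
  connectivity≤degree : ∀ {v} → HasDegree H v d → ∀ j → IsConnected H j → j ≤ d
  connectivity≤degree {v} (N , adj , refl) j (j<order , connected) with j ℕ.≤? ∣ N ∣
  ... | yes j≤d = j≤d
  ... | no j≰d = contradiction (escape (connected N (ℕ.≰⇒> j≰d) v u v∉N u∉N)) (u≢v ∘ sym)
    where
    v∉N : v ∉ N
    v∉N = ~-irrefl ∘ Equivalence.to (adj v)
    outside : ∃ λ u → u ∉ N × u ≢ v
    outside with Fin.any? (λ u → ¬? (u ∈? N) ×-dec ¬? (u Fin.≟ v))
    ... | yes found = found
    ... | no all = contradiction j<order (ℕ.≤⇒≯ (begin
      order                         ≡⟨ sym (length-tabulate id) ⟩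
      length (allFin order)         ≤⟨ length-filter-≢ v (v Fin.≟_) (Unique.allFin⁺ order) ⟩
      suc (length others)           ≤⟨ s≤s (length≤∣ N ∣ uniq (All.tabulate in-N)) ⟩
      suc ∣ N ∣                     ≤⟨ ℕ.≰⇒> j≰d ⟩
      j                             ∎))
      where
      open ℕ.≤-Reasoning
      others = filter (λ u → ¬? (v Fin.≟ u)) (allFin order)
      uniq : Unique others
      uniq = Unique.filter⁺ _ (Unique.allFin⁺ order)
      in-N : ∀ {u} → u ∈ others → u ∈ₛ N
      in-N {u} u∈ = decidable-stable (u ∈? N) λ u∉N →
        all (u , u∉N , proj₂ (∈-filter⁻ _ {xs = allFin order} u∈) ∘ sym)
    u = proj₁ outside
    u∉N = proj₁ (proj₂ outside)
    u≢v = proj₂ (proj₂ outside)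
    escape : ∀ {u} → Star (λ x y → x ∉ N × y ∉ N × x ~ y) v u → v ≡ u
    escape ε = refl
    escape ((_ , w∉N , v~w) ◅ _) = contradiction (Equivalence.from (adj _) v~w) w∉N

-- Segments as unordered pairs of points, and counting them in a vertex set.

module Pairs {c ℓ₁ ℓ₂ : Level} (ℝ : RealField c ℓ₁ ℓ₂) (n : ℕ) (v₀ : Fin (length (Plane.pairs ℝ n))) where
  open Plane ℝ using (pairs)

  Edge : Set
  Edge = Fin (length (pairs n))

  ends : Edge → Fin n × Fin n
  ends = lookup (pairs n)

  ∈-pairs : ∀ {i j} → i Fin.< j → (i , j) ∈ pairs n
  ∈-pairs i<j = ∈-filter⁺ _ (∈-cartesianProduct⁺ (∈-allFin _) (∈-allFin _)) i<j

  ends-< : ∀ e → proj₁ (ends e) Fin.< proj₂ (ends e)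
  ends-< e = proj₂ (∈-filter⁻ _ {xs = cartesianProduct (allFin n) (allFin n)} (∈-lookup e))

  ends-injective : ∀ e f → ends e ≡ ends f → e ≡ f
  ends-injective = lookup-injective
    (Unique.filter⁺ _ (Unique.cartesianProduct⁺ (Unique.allFin⁺ n) (Unique.allFin⁺ n)))

  -- v₀ is the junk value at i = j.
  edge : Fin n → Fin n → Edge
  edge i j with Fin.<-cmp i j
  ... | tri< i<j _ _ = Any.index (∈-pairs i<j)
  ... | tri≈ _ _ _   = v₀
  ... | tri> _ _ j<i = Any.index (∈-pairs j<i)

  ends-edge : ∀ {i j} → i ≢ j → ends (edge i j) ≡ (i , j) ⊎ ends (edge i j) ≡ (j , i)
  ends-edge {i} {j} i≢j with Fin.<-cmp i j
  ... | tri< i<j _ _ = inj₁ (sym (Any.lookup-index (∈-pairs i<j)))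
  ... | tri≈ _ i≡j _ = contradiction i≡j i≢j
  ... | tri> _ _ j<i = inj₂ (sym (Any.lookup-index (∈-pairs j<i)))

  edge-sym : ∀ i j → edge i j ≡ edge j i
  edge-sym i j with Fin.<-cmp i j | Fin.<-cmp j i
  ... | tri< i<j _ _ | tri> _ _ i<j′ = cong (Any.index ∘ ∈-pairs) (Fin.<-irrelevant i<j i<j′)
  ... | tri> _ _ j<i | tri< j<i′ _ _ = cong (Any.index ∘ ∈-pairs) (Fin.<-irrelevant j<i j<i′)
  ... | tri≈ _ _ _   | tri≈ _ _ _    = refl
  ... | tri< _ i≢j _ | tri≈ _ j≡i _  = contradiction (sym j≡i) i≢j
  ... | tri> _ i≢j _ | tri≈ _ j≡i _  = contradiction (sym j≡i) i≢j
  ... | tri≈ _ i≡j _ | tri< _ j≢i _  = contradiction (sym i≡j) j≢i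
  ... | tri≈ _ i≡j _ | tri> _ j≢i _  = contradiction (sym i≡j) j≢i
  ... | tri< _ _ j≮i | tri< j<i _ _  = contradiction j<i j≮i
  ... | tri> i≮j _ _ | tri> _ _ i<j  = contradiction i<j i≮j

  edge-ends : ∀ e → edge (proj₁ (ends e)) (proj₂ (ends e)) ≡ e
  edge-ends e with ends-edge (Fin.<⇒≢ (ends-< e))
  ... | inj₁ eq = ends-injective _ _ eq
  ... | inj₂ eq = contradiction (subst (λ (i , j) → i Fin.< j) eq (ends-< _)) (Fin.<-asym (ends-< e))

  edge-injective : ∀ {i j k l} → i ≢ j → k ≢ l → edge i j ≡ edge k l →
                   (i ≡ k × j ≡ l) ⊎ (i ≡ l × j ≡ k)
  edge-injective i≢j k≢l eq with cong ends eq | ends-edge i≢j | ends-edge k≢l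
  ... | eq′ | inj₁ ij | inj₁ kl = inj₁ (,-injective (≡.trans (sym ij) (≡.trans eq′ kl)))
  ... | eq′ | inj₁ ij | inj₂ lk = inj₂ (,-injective (≡.trans (sym ij) (≡.trans eq′ lk)))
  ... | eq′ | inj₂ ji | inj₁ kl = inj₂ (Product.swap (,-injective (≡.trans (sym ji) (≡.trans eq′ kl))))
  ... | eq′ | inj₂ ji | inj₂ lk = inj₁ (Product.swap (,-injective (≡.trans (sym ji) (≡.trans eq′ lk))))

  module Counting (W : Subset (length (pairs n))) where

    M : Fin n → Fin n → Set
    M i j = edge i j ∈ₛ W

    M? : Decidable M
    M? i j = edge i j ∈? W

    M-sym : Symmetric M
    M-sym {i} {j} = subst (_∈ₛ W) (edge-sym i j)

    missing : Fin n → List (Fin n) → List Edge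
    missing x xs = map (edge x) (filter (M? x) xs)

    allMissing : List (Fin n) → List Edge
    allMissing []       = []
    allMissing (x ∷ xs) = missing x xs ++ allMissing xs

    ∈-missing : ∀ x xs {e} → e ∈ missing x xs → ∃ λ y → y ∈ xs × M x y × e ≡ edge x y
    ∈-missing x xs e∈ with y , y∈ , refl ← ∈-map⁻ (edge x) e∈ with y∈xs , m ← ∈-filter⁻ (M? x) y∈ =
      y , y∈xs , m , refl

    ∈-allMissing : ∀ {xs e} → Unique xs → e ∈ allMissing xs →
                   ∃₂ λ x y → x ∈ xs × y ∈ xs × x ≢ y × M x y × e ≡ edge x y
    ∈-allMissing {x ∷ xs} (x≢xs ∷ uniq) e∈ with ∈-++⁻ (missing x xs) e∈
    ... | inj₁ e∈x with y , y∈ , m , eq ← ∈-missing x xs e∈x =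
      x , y , here refl , there y∈ , All.lookup x≢xs y∈ , m , eq
    ... | inj₂ e∈xs with y , z , y∈ , z∈ , rest ← ∈-allMissing uniq e∈xs =
      y , z , there y∈ , there z∈ , rest

    missing-unique : ∀ {x xs} → All (x ≢_) xs → Unique xs → Unique (missing x xs)
    missing-unique {x} x≢xs uniq =
      AllPairs.map⁺ (distinct (All.filter⁺ _ x≢xs) (Unique.filter⁺ (M? x) uniq))
      where
      distinct : ∀ {ys} → All (x ≢_) ys → Unique ys → AllPairs (λ y z → edge x y ≢ edge x z) ys
      distinct [] [] = []
      distinct (x≢y ∷ x≢ys) (y≢ys ∷ uniq) = All.zipWith
        (λ { (x≢z , y≢z) eq → differ x≢y x≢z y≢z (edge-injective x≢y x≢z eq) })
        (x≢ys , y≢ys) ∷ distinct x≢ys uniq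
        where
        differ : ∀ {y z} → x ≢ y → x ≢ z → y ≢ z → ¬ ((x ≡ x × y ≡ z) ⊎ (x ≡ z × y ≡ x))
        differ _   _   y≢z (inj₁ (_ , y≡z)) = y≢z y≡z
        differ _   x≢z _   (inj₂ (x≡z , _)) = x≢z x≡z

    -- Each segment is listed only at whichever of its ends comes first in `xs`. This is what bounds
    -- the count of deleted segments by the size of `W`.
    allMissing-unique : ∀ {xs} → Unique xs → Unique (allMissing xs)
    allMissing-unique [] = []
    allMissing-unique {x ∷ xs} (x≢xs ∷ uniq) =
      Unique.++⁺ (missing-unique x≢xs uniq) (allMissing-unique uniq) apart
      where
      apart : ∀ {e} → ¬ (e ∈ missing x xs × e ∈ allMissing xs)
      apart (e∈x , e∈xs)
        with y , y∈ , _ , refl ← ∈-missing x xs e∈x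
           | k , l , k∈ , l∈ , k≢l , _ , eq ← ∈-allMissing uniq e∈xs
        with edge-injective (All.lookup x≢xs y∈) k≢l eq
      ... | inj₁ (refl , _) = All.lookup x≢xs k∈ refl
      ... | inj₂ (refl , _) = All.lookup x≢xs l∈ refl

    length-allMissing : ∀ {xs} → Unique xs → length (allMissing xs) ≤ ∣ W ∣
    length-allMissing uniq = length≤∣ W ∣ (allMissing-unique uniq)
      (All.tabulate λ e∈ → in-W (∈-allMissing uniq e∈))
      where
      in-W : ∀ {xs e} → (∃₂ λ x y → x ∈ xs × y ∈ xs × x ≢ y × M x y × e ≡ edge x y) → e ∈ₛ W
      in-W (_ , _ , _ , _ , _ , m , refl) = m

-- Connectedness of the disjointness graph after a small deletion.

module _ {c ℓ₁ ℓ₂ : Level} (ℝ : RealField c ℓ₁ ℓ₂) {n : ℕ} (P : Fin n → Plane.Point ℝ)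
         (generic : Plane.InGeneralPosition ℝ P) where
  open Plane ℝ
  open Orientation ℝ

  -- Walks are sought along the decidable relation `R` of separated surviving segments. It then
  -- suffices that every Boolean colouring respecting `R` is constant on survivors, which is
  -- `monochrome` applied to all the points.
  connectedWithout : ∀ W → ∣ W ∣ < bound (n ∸ 2) → ConnectedWithout (D P) W
  connectedWithout W small e f e∉W f∉W = Star.map
    (λ { {x} {y} (x∉W , y∉W , sep) → x∉W , y∉W , disjoint x y sep })
    (colourings⇒Star R-sym (allFin _) ∈-allFin same)
    where
    -- The given vertex `e` serves as the default value of `edge` on the diagonal.
    open Pairs ℝ n e
    open Counting W

    _∥_ : Edge → Edge → Set _
    x ∥ y = Separated P generic (ends x) (ends y)

    R : Edge → Edge → Set _
    R x y = x ∉ W × y ∉ W × (x ∥ y ⊎ y ∥ x)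

    R? : Decidable R
    R? x y = ¬? (x ∈? W) ×-dec ¬? (y ∈? W) ×-dec
      (Separated? P generic (ends x) (ends y) ⊎-dec Separated? P generic (ends y) (ends x))

    open Reachability Fin._≟_ R?

    R-sym : Symmetric R
    R-sym (x∉ , y∉ , sep) = y∉ , x∉ , Sum.swap sep

    disjoint : ∀ x y → x ∥ y ⊎ y ∥ x → Disjoint (segment P x) (segment P y)
    disjoint x y (inj₁ sep) = Separated⇒Disjoint P generic sep
    disjoint x y (inj₂ sep) (z , z∈x , z∈y) = Separated⇒Disjoint P generic sep (z , z∈y , z∈x)

    same : ∀ (g : Edge → Bool) → (∀ {x y} → R x y → g x ≡ g y) → g e ≡ g f
    same g g-closed = ≡.trans (all-k e∉W) (sym (all-k f∉W))
      where
      parallel : ∀ {u v a b c d} → OnOrRight (L P generic) u v a → OnOrRight (L P generic) u v b →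
        L P generic u v c → L P generic u v d → a ≢ b → c ≢ d → edge a b ∥ edge c d
      parallel {u} {v} a b c d a≢b c≢d with ends-edge a≢b | ends-edge c≢d
      ... | inj₁ ab | inj₁ cd rewrite ab | cd = u , v , a , b , c , d
      ... | inj₁ ab | inj₂ dc rewrite ab | dc = u , v , a , b , d , c
      ... | inj₂ ba | inj₁ cd rewrite ba | cd = u , v , b , a , c , d
      ... | inj₂ ba | inj₂ dc rewrite ba | dc = u , v , b , a , d , c

      module C = Colouring Fin._≟_ (L P generic) (L-total P generic) (L-asym P generic)
        (L-cyclic P generic) (arrange P generic) M M? (λ {i} {j} → M-sym {i} {j})
        (λ i j → g (edge i j)) (λ i j → cong g (edge-sym i j))
        (λ a b c d a≢b c≢d ab∉W cd∉W → g-closed (ab∉W , cd∉W , inj₁ (parallel a b c d a≢b c≢d)))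

      totalMissing-length : ∀ xs → C.totalMissing xs ≡ length (allMissing xs)
      totalMissing-length []       = refl
      totalMissing-length (x ∷ xs) = sym (≡.trans (length-++ (missing x xs))
        (cong₂ _+_ (length-map (edge x) (filter (M? x) xs)) (sym (totalMissing-length xs))))

      few : C.Few (allFin n)
      few = begin-strict
        C.totalMissing (allFin n)       ≡⟨ totalMissing-length (allFin n) ⟩
        length (allMissing (allFin n))  ≤⟨ length-allMissing (Unique.allFin⁺ n) ⟩
        ∣ W ∣                           <⟨ small ⟩
        bound (n ∸ 2)                   ≡⟨ cong (λ m → bound (m ∸ 2)) (sym (length-tabulate {n = n} id)) ⟩
        bound (length (allFin n) ∸ 2)   ∎
        where open ℕ.≤-Reasoning

      mono : C.Monochrome (allFin n)
      mono = C.monochrome _ (allFin n) refl (Unique.allFin⁺ n) few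

      all-k : ∀ {x} → x ∉ W → g x ≡ proj₁ mono
      all-k {x} x∉W = ≡.trans (cong g (sym (edge-ends x)))
        (proj₂ mono (∈-allFin _) (∈-allFin _)
          (Fin.<⇒≢ (ends-< x) , x∉W ∘ subst (_∈ₛ W) (edge-ends x)))

corollary1 : ∀ {c ℓ₁ ℓ₂ : Level} (ℝ : RealField c ℓ₁ ℓ₂) (n : ℕ) → 3 ≤ n →
    (P : Fin n → Plane.Point ℝ) → Plane.InGeneralPosition ℝ P →
    HasMinimumDegree (Plane.D ℝ P) (⌊ n ∸ 2 /2⌋ C 2 + ⌈ n ∸ 2 /2⌉ C 2) →
    HasConnectivity (Plane.D ℝ P) (⌊ n ∸ 2 /2⌋ C 2 + ⌈ n ∸ 2 /2⌉ C 2)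
corollary1 ℝ n _ P generic ((v , deg) , _) =
  -- A vertex attaining the minimum degree yields both the condition on the order and the upper
  -- bound.
  (degree<order (Plane.D ℝ P) deg , connectedWithout ℝ P generic) ,
  connectivity≤degree (Plane.D ℝ P) deg
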